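{- There are positive constants $c$ and $C$ such that for all positive integers $r$, \[ c\, r^{3/5} < f(r, \theta_{3,4}) < C\, r^{3/5}. \]
   Context: Let $r,k$ be positive integers. A graph $G$ is an $(r,k)$-graph if $V(G)$ can be partitioned into sets $V_1,\dots,V_r$ with $|V_i| \le k$ for all $i$ such that for every pair $i \neq j$ in $[r]$ there is an edge of $G$ with one endpoint in $V_i$ and the other in $V_j$. For a graph $H$, $f(r,H)$ is the minimum $k$ such that there exists an $H$-free $(r,k)$-graph. For integers $K,\ell \ge 2$, the theta graph $\theta_{K,\ell}$ is the graph consisting of $K$ internally vertex-disjoint paths, each of length $\ell$, all having the same two endpoints. -}

module Defs where

open import Data.Nat using (ℕ; zero; suc; _≤_; _<_)
open import Data.Fin using (Fin; zero; suc; fromℕ; inject₁) renaming (_≟_ to _≟F_)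
open import Data.Bool using (Bool; true; false)
open import Data.List using (length; filter; allFin)
open import Data.Product using (Σ; _×_; ∃)
open import Data.Sum using (_⊎_)
open import Relation.Nullary using (¬_)
open import Relation.Binary.PropositionalEquality using (_≡_; _≢_)

record Graph : Set where
  field
    n     : ℕ
    adj   : Fin n → Fin n → Bool
    sym   : ∀ u v → adj u v ≡ adj v u
    loopless : ∀ v → adj v v ≡ false

open Graph public

Edge : (G : Graph) → Fin (n G) → Fin (n G) → Set
Edge G u v = adj G u v ≡ true

partSize : ∀ {m r} → (Fin m → Fin r) → Fin r → ℕ
partSize {m} p i = length (filter (λ v → p v ≟F i) (allFin m))

IsRKGraph : ℕ → ℕ → Graph → Set
IsRKGraph r k G =
  Σ (Fin (n G) → Fin r) λ p →
    (∀ i → partSize p i ≤ k) ×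
    (∀ i j → i ≢ j →
       Σ (Fin (n G)) λ u → Σ (Fin (n G)) λ v →
         p u ≡ i × p v ≡ j × Edge G u v)

ThetaCopy : ℕ → ℕ → Graph → Set
ThetaCopy K ℓ G =
  Σ (Fin (n G)) λ x → Σ (Fin (n G)) λ y →
  Σ (Fin K → Fin (suc ℓ) → Fin (n G)) λ W →
    (∀ i → W i zero ≡ x) ×
    (∀ i → W i (fromℕ ℓ) ≡ y) ×
    (∀ i (j : Fin ℓ) → Edge G (W i (inject₁ j)) (W i (suc j))) ×
    (∀ i i' j j' → W i j ≡ W i' j' →
        (i ≡ i' × j ≡ j')
      ⊎ (j ≡ zero × j' ≡ zero)
      ⊎ (j ≡ fromℕ ℓ × j' ≡ fromℕ ℓ))

ThetaFree : ℕ → ℕ → Graph → Set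
ThetaFree K ℓ G = ¬ ThetaCopy K ℓ G

HasFreeRK : ℕ → ℕ → ℕ → ℕ → Set
HasFreeRK r K ℓ k = ∃ λ (G : Graph) → ThetaFree K ℓ G × IsRKGraph r k G

IsF : ℕ → ℕ → ℕ → ℕ → Set
IsF r K ℓ k =
  1 ≤ k × HasFreeRK r K ℓ k ×
  (∀ k' → 1 ≤ k' → k' < k → ¬ HasFreeRK r K ℓ k')

{-# OPTIONS --safe #-}
-- Lower bound. Let L₀, L₁, … be the distance levels around a vertex x of a θ₃,₄-free graph. The number of edges between
-- Lᵢ and Lᵢ ∪ Lᵢ₊₁ is O(|Lᵢ| + |Lᵢ₊₁|) for i ≤ 3: colour Lᵢ by ancestors in L₁. If many vertices see many colours, then
-- three paths with different colours close up to a θ₃,₄; otherwise the edges are essentially split into the subtrees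
-- below the vertices of L₁, and i drops by one. Hence a graph of minimum degree d has Ω(d⁴) vertices. An (r,k)-graph has
-- at most rk vertices and at least r(r-1)/2 edges, so it contains a subgraph with d = Ω(r/k), whence rk = Ω((r/k)⁴).
--
-- Upper bound. Over 𝔽_p take points (a₁,…,a₄) and lines (b₁,…,b₄), incident when a₂ + b₂ = a₁b₁, a₃ + b₃ = a₁b₁²,
-- a₄ + b₄ = a₁²b₁ (Verstraëte and Williford). For given end points, the middle vertex of a path of length four is a root
-- of a quadratic polynomial that determines the path, so there is no θ₃,₄. With s ≈ √p, a part consists of all points and
-- lines with prescribed first coordinate and prescribed "halves" of the other coordinates: the high digit in base 2s for
-- points and the low digit in base s for lines. Any two parts are then joined, and r = s⁵, k = O(s³). Suitable primes
-- exist by Chebyshev's argument: lcm(1,…,2n) ≥ 2ⁿ, while ∏_{q ≤ n} q ≤ 4ⁿ for n a power of two.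
module Submission where

open import Defs hiding (n; sym)
open import Data.Nat using (ℕ)
open import Data.Nat.Primality using (Prime; euclidsLemma)
open import Data.Bool using (Bool; true; false; not)
import Data.Bool.Properties as BoolP
open import Data.Fin using (Fin; zero; suc; toℕ; fromℕ; fromℕ<; inject₁; inject≤; combine; remQuot) renaming (_≟_ to _≟F_)
open import Data.Fin.Patterns
import Data.Fin.Properties as FinP
open import Data.Product using (_×_; _,_; ∃; ∃₂; Σ; proj₁; proj₂)
open import Data.Sum using (_⊎_; inj₁; inj₂)
open import Data.Empty using (⊥)
open import Data.Unit using (⊤; tt)
open import Function using (_∘_; _∋_; id; flip; _↔_; Inverse; mk⇔)
open import Relation.Nullary using (Dec; yes; no; ¬_; contradiction; does)
open import Relation.Nullary.Decidable using (_×-dec_; _⊎-dec_; _→-dec_; ¬?; True; toWitness; from-yes; map′; does-⇔; dec-true; dec-false)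
open import Relation.Binary.PropositionalEquality using (_≡_; _≢_; refl; sym; trans; cong; cong₂; subst; subst₂; module ≡-Reasoning)

-- Paths of length four modulo a prime

-- Fifth powers replace real exponents: c r^(3/5) < f becomes r³ < N f⁵ with N = c⁻⁵, and f < C
-- r^(3/5) becomes f⁵ < M r³ with M = C⁵. That a least k exists has to be computed: an (r,k)-graph
-- has at most rk vertices, so `HasFreeRK` is settled by a finite search, started from the k of the
-- upper bound.
--
-- In the lower bound every theta graph is built greedily, one of its 11 vertices after another; the
-- constants 4, 7, 10, 9, 8 count vertices to be avoided. The obstacle is that three paths from x
-- must not meet. Avoiding the colours of all vertices used so far, rather than the vertices, keeps
-- a new vertex and its ancestors clear of them at once.
--
-- In the upper bound the quadratic may degenerate: the end points may share their first coordinate,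
-- or its leading coefficient may vanish. The first is impossible once two suitable paths exist, the
-- second once one does. Parts must be small and yet joined whatever their labels are: fixing the
-- high digits of points and the low digits of lines leaves complementary digits free, whose
-- combinations reach every residue.

module Congruences where

  open import Data.Integer
  open import Data.Integer.Properties using (abs-*)
  open import Data.Integer.Divisibility.Signed
  open import Data.Integer.Tactic.RingSolver using (solve-∀)

  module Mod (p : ℕ) (p-prime : Prime p) (2∤ : ¬ + p ∣ + 2) where

    Null : ℤ → Set
    Null z = + p ∣ z

    domain : ∀ a b → Null (a * b) → Null a ⊎ Null b
    domain a b n with euclidsLemma ∣ a ∣ ∣ b ∣ p-prime (subst (ℕ∣ p) (abs-* a b) (∣⇒∣ᵤ n))
      where open import Data.Nat.Divisibility using () renaming (_∣_ to ℕ∣)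
    ... | inj₁ d = inj₁ (∣ᵤ⇒∣ d)
    ... | inj₂ d = inj₂ (∣ᵤ⇒∣ d)

    cancel : ∀ a {b} → ¬ Null a → Null (a * b) → Null b
    cancel a ¬a n with domain a _ n
    ... | inj₁ d = contradiction d ¬a
    ... | inj₂ d = d

    square : ∀ a → Null (a * a) → Null a
    square a n with domain a a n
    ... | inj₁ d = d
    ... | inj₂ d = d

    lin₂ : ∀ a b {x y z} → Null x → Null y → a * x + b * y ≡ z → Null z
    lin₂ a b nx ny refl = ∣m∣n⇒∣m+n (∣n⇒∣m*n a nx) (∣n⇒∣m*n b ny)

    null? : ∀ a → Dec (Null a)
    null? a = + p ∣? a

    -- A path of length four from a point with first coordinate u to one with first coordinate v, whose inner vertices
    -- have first coordinates β, α, γ; the quantities D₂, D₃, D₄ depend on the two end points only.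
    record Path (u v D₂ D₃ D₄ α β γ : ℤ) : Set where
      field
        e₂  : Null ((u - α) * β + (α - v) * γ - D₂)
        e₃  : Null ((u - α) * (β * β) + (α - v) * (γ * γ) - D₃)
        e₄  : Null ((u * u - α * α) * β + (α * α - v * v) * γ - D₄)
        u≢α : ¬ Null (u - α)
        α≢v : ¬ Null (α - v)
        β≢γ : ¬ Null (β - γ)

    module _ {u v D₂ D₃ D₄ : ℤ} where

      Δ A : ℤ
      Δ = u - v
      A = D₄ - (u + v) * D₂

      module _ {α β γ : ℤ} (P : Path u v D₂ D₃ D₄ α β γ) where
        open Path P
        s t : ℤ
        s = u - α
        t = α - v

        -- Subtracting α + v times `e₂` from `e₄` eliminates γ; `right` eliminates β in the same
        -- way.
        left : Null (Δ * (s * β) - (A + D₂ * s))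
        left = lin₂ 1ℤ (- (α + v)) e₄ e₂ (id₁ u v α β γ D₂ D₄)
          where
          id₁ : ∀ u v α β γ D₂ D₄ →
            1ℤ * ((u * u - α * α) * β + (α * α - v * v) * γ - D₄) + - (α + v) * ((u - α) * β + (α - v) * γ - D₂)
            ≡ (u - v) * ((u - α) * β) - (D₄ - (u + v) * D₂ + D₂ * (u - α))
          id₁ = solve-∀

        right : Null (Δ * (t * γ) - (- A + D₂ * t))
        right = lin₂ (- 1ℤ) (u + α) e₄ e₂ (id₂ u v α β γ D₂ D₄)
          where
          id₂ : ∀ u v α β γ D₂ D₄ →
            - 1ℤ * ((u * u - α * α) * β + (α * α - v * v) * γ - D₄) + (u + α) * ((u - α) * β + (α - v) * γ - D₂)
            ≡ (u - v) * ((α - v) * γ) - (- (D₄ - (u + v) * D₂) + D₂ * (α - v))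
          id₂ = solve-∀

        -- t (A + D₂ s)² + s (− A + D₂ t)² = Δ (A² + D₂² s t), because s + t = Δ.
        quadratic : ¬ Null Δ → Null (A * A - (Δ * D₃ - D₂ * D₂) * (s * t))
        quadratic Δ≢0 = cancel Δ Δ≢0 (lin₂ 1ℤ (Δ * Δ * (s * t)) (lin₂ (t * (f - x - x)) (s * (g - y - y)) left right refl) e₃
          (id₃ u v α β γ D₂ D₃ D₄))
          where
          x y f g : ℤ
          x = Δ * (s * β)
          y = Δ * (t * γ)
          -- f (f - 2x) = (A + D₂ s)² - x², and similarly for g; so x² and y², which `e₃` times Δ² s
          -- t produces, can be replaced.
          f = Δ * (s * β) - (A + D₂ * s)
          g = Δ * (t * γ) - (- A + D₂ * t)
          id₃ : ∀ u v α β γ D₂ D₃ D₄ →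
            let s = u - α ; t = α - v ; Δ = u - v ; A = D₄ - (u + v) * D₂
                x = Δ * (s * β) ; y = Δ * (t * γ)
                f = Δ * (s * β) - (A + D₂ * s) ; g = Δ * (t * γ) - (- A + D₂ * t) in
            1ℤ * (t * (f - x - x) * f + s * (g - y - y) * g) + Δ * Δ * (s * t) * (s * (β * β) + t * (γ * γ) - D₃)
            ≡ Δ * (A * A - (Δ * D₃ - D₂ * D₂) * (s * t))
          id₃ = solve-∀

      degenerate : ∀ {α β γ} (P : Path u v D₂ D₃ D₄ α β γ) → Null Δ → Null ((u - α) * (β - γ) - D₂)
      degenerate {α} {β} {γ} P Δ≡0 = lin₂ 1ℤ (- γ) (Path.e₂ P) Δ≡0 (id₄ u v α β γ D₂)
        where
        id₄ : ∀ u v α β γ D₂ → 1ℤ * ((u - α) * β + (α - v) * γ - D₂) + - γ * (u - v) ≡ (u - α) * (β - γ) - D₂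
        id₄ = solve-∀

      degenerate² : ∀ {α β γ} (P : Path u v D₂ D₃ D₄ α β γ) → Null Δ → Null ((u - α) * ((β - γ) * (β + γ)) - D₃)
      degenerate² {α} {β} {γ} P Δ≡0 = lin₂ 1ℤ (- (γ * γ)) (Path.e₃ P) Δ≡0 (id₅ u v α β γ D₃)
        where
        id₅ : ∀ u v α β γ D₃ →
          1ℤ * ((u - α) * (β * β) + (α - v) * (γ * γ) - D₃) + - (γ * γ) * (u - v) ≡ (u - α) * ((β - γ) * (β + γ)) - D₃
        id₅ = solve-∀

      -- α determines β. For Δ ≠ 0 this is `left`. For Δ = 0, D₂ and D₃ fix s (β - γ) and s (β -
      -- γ)(β + γ), hence β - γ and β + γ, hence 2 β; here p has to be odd.
      middles-differ : ∀ {α β γ α′ β′ γ′} → Path u v D₂ D₃ D₄ α β γ → Path u v D₂ D₃ D₄ α′ β′ γ′ →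
        ¬ Null (β - β′) → ¬ Null (α - α′)
      middles-differ {α} {β} {γ} {α′} {β′} {γ′} P P′ β≢β′ α≡α′ with null? Δ
      ... | no Δ≢0 = β≢β′ (cancel (u - α) (Path.u≢α P) (cancel Δ Δ≢0
              (lin₂ 1ℤ (Δ * β′ - D₂) (lin₂ 1ℤ (- 1ℤ) (left P) (left P′) refl) α≡α′ (id₆ Δ A D₂ u α α′ β β′))))
        where
        id₆ : ∀ Δ A D₂ u α α′ β β′ →
          1ℤ * (1ℤ * (Δ * ((u - α) * β) - (A + D₂ * (u - α))) + - 1ℤ * (Δ * ((u - α′) * β′) - (A + D₂ * (u - α′))))
            + (Δ * β′ - D₂) * (α - α′)
          ≡ Δ * ((u - α) * (β - β′))
        id₆ = solve-∀
      ... | yes Δ≡0 = β≢β′ (cancel (+ 2) 2∤ (lin₂ 1ℤ 1ℤ differences sums (id₉ β γ β′ γ′)))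
        where
        id₇ : ∀ u α α′ x x′ D →
          1ℤ * (1ℤ * ((u - α) * x - D) + - 1ℤ * ((u - α′) * x′ - D)) + x′ * (α - α′) ≡ (u - α) * (x - x′)
        id₇ = solve-∀
        id₈ : ∀ β γ β′ γ′ →
          1ℤ * ((β - γ) * (β + γ) - (β′ - γ′) * (β′ + γ′)) + - (β′ + γ′) * (β - γ - (β′ - γ′))
          ≡ (β - γ) * (β + γ - (β′ + γ′))
        id₈ = solve-∀
        id₉ : ∀ β γ β′ γ′ → 1ℤ * (β - γ - (β′ - γ′)) + 1ℤ * (β + γ - (β′ + γ′)) ≡ + 2 * (β - β′)
        id₉ = solve-∀
        differences : Null (β - γ - (β′ - γ′))
        differences = cancel (u - α) (Path.u≢α P)
          (lin₂ 1ℤ (β′ - γ′) (lin₂ 1ℤ (- 1ℤ) (degenerate P Δ≡0) (degenerate P′ Δ≡0) refl) α≡α′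
            (id₇ u α α′ (β - γ) (β′ - γ′) D₂))
        squares : Null ((β - γ) * (β + γ) - (β′ - γ′) * (β′ + γ′))
        squares = cancel (u - α) (Path.u≢α P)
          (lin₂ 1ℤ ((β′ - γ′) * (β′ + γ′)) (lin₂ 1ℤ (- 1ℤ) (degenerate² P Δ≡0) (degenerate² P′ Δ≡0) refl) α≡α′
            (id₇ u α α′ ((β - γ) * (β + γ)) ((β′ - γ′) * (β′ + γ′)) D₃))
        sums : Null (β + γ - (β′ + γ′))
        sums = cancel (β - γ) (Path.β≢γ P) (lin₂ 1ℤ (- (β′ + γ′)) squares differences (id₈ β γ β′ γ′))

      -- If Δ = 0, then `left` reads A + D₂ s = 0 on both paths, while D₂ = s (β - γ) ≠ 0; so the
      -- two values of s, and with them α and α′, would agree.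
      non-degenerate : ∀ {α β γ α′ β′ γ′} → Path u v D₂ D₃ D₄ α β γ → Path u v D₂ D₃ D₄ α′ β′ γ′ →
        ¬ Null (β - β′) → ¬ Null Δ
      non-degenerate {α} {β} {γ} {α′} {β′} P P′ β≢β′ Δ≡0 =
        middles-differ P P′ β≢β′ (cancel D₂ D₂≢0
          (lin₂ 1ℤ ((u - α′) * β′ - (u - α) * β) (lin₂ 1ℤ (- 1ℤ) (left P) (left P′) refl) Δ≡0 (id₁₁ Δ A D₂ u α α′ β β′)))
        where
        id₁₀ : ∀ x D → 1ℤ * (x - D) + 1ℤ * D ≡ x
        id₁₀ = solve-∀
        id₁₁ : ∀ Δ A D₂ u α α′ β β′ →
          1ℤ * (1ℤ * (Δ * ((u - α) * β) - (A + D₂ * (u - α))) + - 1ℤ * (Δ * ((u - α′) * β′) - (A + D₂ * (u - α′))))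
            + ((u - α′) * β′ - (u - α) * β) * Δ
          ≡ D₂ * (α - α′)
        id₁₁ = solve-∀
        D₂≢0 : ¬ Null D₂
        D₂≢0 n = Path.β≢γ P (cancel (u - α) (Path.u≢α P)
          (lin₂ 1ℤ 1ℤ (degenerate P Δ≡0) n (id₁₀ ((u - α) * (β - γ)) D₂)))

      F : ℤ
      F = Δ * D₃ - D₂ * D₂

      -- F = 0 forces A = 0 by the quadratic; then `left` and `right` give Δ β = D₂ = Δ γ, although
      -- β ≠ γ.
      F≢0 : ∀ {α β γ} → Path u v D₂ D₃ D₄ α β γ → ¬ Null Δ → ¬ Null F
      F≢0 {α} {β} {γ} P Δ≢0 F≡0 = Path.β≢γ P (cancel Δ Δ≢0 (lin₂ 1ℤ (- 1ℤ) Δβ Δγ (id₁₄ Δ D₂ β γ)))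
        where
        id₁₂ : ∀ A F x → 1ℤ * (A * A - F * x) + x * F ≡ A * A
        id₁₂ = solve-∀
        id₁₃ : ∀ Δ A D s β → 1ℤ * (Δ * (s * β) - (A + D * s)) + 1ℤ * A ≡ s * (Δ * β - D)
        id₁₃ = solve-∀
        id₁₃′ : ∀ Δ A D t γ → 1ℤ * (Δ * (t * γ) - (- A + D * t)) + - 1ℤ * A ≡ t * (Δ * γ - D)
        id₁₃′ = solve-∀
        id₁₄ : ∀ Δ D β γ → 1ℤ * (Δ * β - D) + - 1ℤ * (Δ * γ - D) ≡ Δ * (β - γ)
        id₁₄ = solve-∀
        A≡0 : Null A
        A≡0 = square A (lin₂ 1ℤ ((u - α) * (α - v)) (quadratic P Δ≢0) F≡0 (id₁₂ A F ((u - α) * (α - v))))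
        Δβ : Null (Δ * β - D₂)
        Δβ = cancel (u - α) (Path.u≢α P) (lin₂ 1ℤ 1ℤ (left P) A≡0 (id₁₃ Δ A D₂ (u - α) β))
        Δγ : Null (Δ * γ - D₂)
        Δγ = cancel (α - v) (Path.α≢v P) (lin₂ 1ℤ (- 1ℤ) (right P) A≡0 (id₁₃′ Δ A D₂ (α - v) γ))

      -- s t takes the same value on both paths and s + t = Δ, so distinct values of s are the two roots of one quadratic.
      middles-sum : ∀ {α β γ α′ β′ γ′} → Path u v D₂ D₃ D₄ α β γ → Path u v D₂ D₃ D₄ α′ β′ γ′ →
        ¬ Null (β - β′) → Null (α + α′ - (u + v))
      middles-sum {α} {β} {γ} {α′} P P′ β≢β′ = cancel (α - α′) (middles-differ P P′ β≢β′) (cancel F (F≢0 P Δ≢0)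
          (lin₂ 1ℤ (- 1ℤ) (quadratic P Δ≢0) (quadratic P′ Δ≢0) (id₁₅ A F u v α α′)))
        where
        Δ≢0 : ¬ Null Δ
        Δ≢0 = non-degenerate P P′ β≢β′
        id₁₅ : ∀ A F u v α α′ →
          1ℤ * (A * A - F * ((u - α) * (α - v))) + - 1ℤ * (A * A - F * ((u - α′) * (α′ - v)))
          ≡ F * ((α - α′) * (α + α′ - (u + v)))
        id₁₅ = solve-∀

      -- Both α′ and α″ would have to equal u + v - α.
      no-three-paths : ∀ {α β γ α′ β′ γ′ α″ β″ γ″} →
        Path u v D₂ D₃ D₄ α β γ → Path u v D₂ D₃ D₄ α′ β′ γ′ → Path u v D₂ D₃ D₄ α″ β″ γ″ →
        ¬ Null (β - β′) → ¬ Null (β - β″) → ¬ Null (β′ - β″) → ⊥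
      no-three-paths {α} {α′ = α′} {α″ = α″} P P′ P″ β≢β′ β≢β″ β′≢β″ = middles-differ P′ P″ β′≢β″
        (lin₂ 1ℤ (- 1ℤ) (middles-sum P P′ β≢β′) (middles-sum P P″ β≢β″) (id₁₆ α α′ α″ (u + v)))
        where
        id₁₆ : ∀ α α′ α″ w → 1ℤ * (α + α′ - w) + - 1ℤ * (α + α″ - w) ≡ α′ - α″
        id₁₆ = solve-∀

  -- The graph of points and lines

  module Incidence (p : ℕ) (p-prime : Prime p) (2∤ : ¬ + p ∣ + 2)
    {V : Set} (side : V → Bool) (c₁ c₂ c₃ c₄ : V → ℤ) where

    open Mod p p-prime 2∤

    record Incident (d₃ d₄ : V → ℤ) (a b : V) : Set where
      constructor incident
      field
        i₂ : Null (c₂ a + c₂ b - c₁ a * c₁ b)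
        i₃ : Null (d₃ a + d₃ b - c₁ a * (c₁ b * c₁ b))
        i₄ : Null (d₄ a + d₄ b - c₁ a * c₁ a * c₁ b)

    open Incident

    Adjacent : V → V → Set
    Adjacent v w =
      (side v ≡ true × side w ≡ false × Incident c₃ c₄ v w) ⊎ (side v ≡ false × side w ≡ true × Incident c₃ c₄ w v)

    Adjacent-sym : ∀ {v w} → Adjacent v w → Adjacent w v
    Adjacent-sym (inj₁ (s , t , i)) = inj₂ (t , s , i)
    Adjacent-sym (inj₂ (s , t , i)) = inj₁ (t , s , i)

    -- Interchanging points and lines interchanges the third and the fourth coordinate.
    d₃ d₄ : Bool → V → ℤ
    d₃ true  = c₃
    d₃ false = c₄
    d₄ true  = c₄
    d₄ false = c₃

    Null-≡ : ∀ {x y} → x ≡ y → Null x → Null y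
    Null-≡ refl n = n

    oriented : ∀ σ {v w} → Adjacent v w → side v ≡ σ → Incident (d₃ σ) (d₄ σ) v w × side w ≡ not σ
    oriented true  (inj₁ (_ , t , i)) _ = i , t
    oriented false {v} {w} (inj₂ (_ , t , incident i₂ i₃ i₄)) _ =
      incident (Null-≡ (e₂ (c₂ w) (c₂ v) (c₁ w) (c₁ v)) i₂)
               (Null-≡ (e₄ (c₄ w) (c₄ v) (c₁ w) (c₁ v)) i₄)
               (Null-≡ (e₃ (c₃ w) (c₃ v) (c₁ w) (c₁ v)) i₃) , t
      where
      e₂ : ∀ x y a b → x + y - a * b ≡ y + x - b * a
      e₂ = solve-∀
      e₃ : ∀ x y a b → x + y - a * (b * b) ≡ y + x - b * b * a
      e₃ = solve-∀
      e₄ : ∀ x y a b → x + y - a * a * b ≡ y + x - b * (a * a)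
      e₄ = solve-∀
    oriented true  (inj₂ (s , _)) s′ = contradiction (trans (sym s) s′) λ ()
    oriented false (inj₁ (s , _)) s′ = contradiction (trans (sym s) s′) λ ()

    -- Vertices are abstract with coordinate maps, because the graph built later contains only some
    -- points and lines, indexed by label and position.
    module Faithful (faithful : ∀ {v w} → side v ≡ side w → Null (c₁ v - c₁ w) → Null (c₂ v - c₂ w) →
                       Null (c₃ v - c₃ w) → Null (c₄ v - c₄ w) → v ≡ w) where

      faithful′ : ∀ σ {v w} → side v ≡ side w → Null (c₁ v - c₁ w) → Null (c₂ v - c₂ w) →
        Null (d₃ σ v - d₃ σ w) → Null (d₄ σ v - d₄ σ w) → v ≡ w
      faithful′ true  s n₁ n₂ n₃ n₄ = faithful s n₁ n₂ n₃ n₄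
      faithful′ false s n₁ n₂ n₃ n₄ = faithful s n₁ n₂ n₄ n₃

      lin₃ : ∀ k {x y z t} → Null x → Null y → Null z → 1ℤ * (1ℤ * x + - 1ℤ * y) + k * z ≡ t → Null t
      lin₃ k nx ny nz eq = lin₂ 1ℤ k (lin₂ 1ℤ (- 1ℤ) nx ny refl) nz eq

      -- A line and the first coordinate of a point on it determine the point. Distinct neighbours
      -- of one vertex thus have distinct first coordinates, the source of the inequalities in
      -- `Path`.
      same-line : ∀ σ {a a′ b} → side a ≡ side a′ → Incident (d₃ σ) (d₄ σ) a b → Incident (d₃ σ) (d₄ σ) a′ b →
        Null (c₁ a - c₁ a′) → a ≡ a′
      same-line σ {a} {a′} {b} s I J n = faithful′ σ s n
        (lin₃ (c₁ b) (i₂ I) (i₂ J) n (e₂ (c₂ a) (c₂ a′) (c₂ b) (c₁ a) (c₁ a′) (c₁ b)))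
        (lin₃ (c₁ b * c₁ b) (i₃ I) (i₃ J) n (e₂ (d₃ σ a) (d₃ σ a′) (d₃ σ b) (c₁ a) (c₁ a′) (c₁ b * c₁ b)))
        (lin₃ ((c₁ a + c₁ a′) * c₁ b) (i₄ I) (i₄ J) n (e₄ (d₄ σ a) (d₄ σ a′) (d₄ σ b) (c₁ a) (c₁ a′) (c₁ b)))
        where
        e₂ : ∀ x x′ y a a′ b → 1ℤ * (1ℤ * (x + y - a * b) + - 1ℤ * (x′ + y - a′ * b)) + b * (a - a′) ≡ x - x′
        e₂ = solve-∀
        e₄ : ∀ x x′ y a a′ b → 1ℤ * (1ℤ * (x + y - a * a * b) + - 1ℤ * (x′ + y - a′ * a′ * b)) + (a + a′) * b * (a - a′) ≡ x - x′
        e₄ = solve-∀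

      same-point : ∀ σ {a b b′} → side b ≡ side b′ → Incident (d₃ σ) (d₄ σ) a b → Incident (d₃ σ) (d₄ σ) a b′ →
        Null (c₁ b - c₁ b′) → b ≡ b′
      same-point σ {a} {b} {b′} s I J n = faithful′ σ s n
        (lin₃ (c₁ a) (i₂ I) (i₂ J) n (e₂ (c₂ a) (c₂ b) (c₂ b′) (c₁ a) (c₁ b) (c₁ b′)))
        (lin₃ (c₁ a * (c₁ b + c₁ b′)) (i₃ I) (i₃ J) n (e₃ (d₃ σ a) (d₃ σ b) (d₃ σ b′) (c₁ a) (c₁ b) (c₁ b′)))
        (lin₃ (c₁ a * c₁ a) (i₄ I) (i₄ J) n (e₂ (d₄ σ a) (d₄ σ b) (d₄ σ b′) (c₁ a * c₁ a) (c₁ b) (c₁ b′)))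
        where
        e₂ : ∀ x y y′ a b b′ → 1ℤ * (1ℤ * (x + y - a * b) + - 1ℤ * (x + y′ - a * b′)) + a * (b - b′) ≡ y - y′
        e₂ = solve-∀
        e₃ : ∀ x y y′ a b b′ →
          1ℤ * (1ℤ * (x + y - a * (b * b)) + - 1ℤ * (x + y′ - a * (b′ * b′))) + a * (b + b′) * (b - b′) ≡ y - y′
        e₃ = solve-∀

      lin₄ : ∀ {x y z w t} → Null x → Null y → Null z → Null w →
        1ℤ * (1ℤ * y + - 1ℤ * x) + 1ℤ * (1ℤ * w + - 1ℤ * z) ≡ t → Null t
      lin₄ nx ny nz nw = lin₂ 1ℤ 1ℤ (lin₂ 1ℤ (- 1ℤ) ny nx refl) (lin₂ 1ℤ (- 1ℤ) nw nz refl)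

      -- The alternating sum of the four incidences along x, b, m, b′, y cancels all coordinates of
      -- inner vertices except the first ones.
      telescope : ∀ x b m b′ y p q r s →
        1ℤ * (1ℤ * (m + b - q) + - 1ℤ * (x + b - p)) + 1ℤ * (1ℤ * (y + b′ - s) + - 1ℤ * (m + b′ - r))
        ≡ p - q + (r - s) - (x - y)
      telescope = solve-∀

      path : ∀ σ {x b m b′ y} → side x ≡ side m → side m ≡ side y → side b ≡ side b′ →
        Incident (d₃ σ) (d₄ σ) x b → Incident (d₃ σ) (d₄ σ) m b → Incident (d₃ σ) (d₄ σ) m b′ → Incident (d₃ σ) (d₄ σ) y b′ →
        x ≢ m → m ≢ y → b ≢ b′ →
        Path (c₁ x) (c₁ y) (c₂ x - c₂ y) (d₃ σ x - d₃ σ y) (d₄ σ x - d₄ σ y) (c₁ m) (c₁ b) (c₁ b′)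
      path σ {x} {b} {m} {b′} {y} xm my bb I₁ I₂ I₃ I₄ x≢m m≢y b≢b′ = record
        { e₂ = lin₄ (i₂ I₁) (i₂ I₂) (i₂ I₃) (i₂ I₄)
                 (trans (telescope (c₂ x) (c₂ b) (c₂ m) (c₂ b′) (c₂ y) (c₁ x * c₁ b) (c₁ m * c₁ b) (c₁ m * c₁ b′) (c₁ y * c₁ b′))
                        (factor (c₁ x) (c₁ y) (c₁ m) (c₁ b) (c₁ b′) (c₂ x - c₂ y)))
        ; e₃ = lin₄ (i₃ I₁) (i₃ I₂) (i₃ I₃) (i₃ I₄)
                 (trans (telescope (d₃ σ x) (d₃ σ b) (d₃ σ m) (d₃ σ b′) (d₃ σ y) (c₁ x * (c₁ b * c₁ b)) (c₁ m * (c₁ b * c₁ b)) (c₁ m * (c₁ b′ * c₁ b′)) (c₁ y * (c₁ b′ * c₁ b′)))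
                        (factor (c₁ x) (c₁ y) (c₁ m) (c₁ b * c₁ b) (c₁ b′ * c₁ b′) (d₃ σ x - d₃ σ y)))
        ; e₄ = lin₄ (i₄ I₁) (i₄ I₂) (i₄ I₃) (i₄ I₄)
                 (trans (telescope (d₄ σ x) (d₄ σ b) (d₄ σ m) (d₄ σ b′) (d₄ σ y) (c₁ x * c₁ x * c₁ b) (c₁ m * c₁ m * c₁ b) (c₁ m * c₁ m * c₁ b′) (c₁ y * c₁ y * c₁ b′))
                        (factor (c₁ x * c₁ x) (c₁ y * c₁ y) (c₁ m * c₁ m) (c₁ b) (c₁ b′) (d₄ σ x - d₄ σ y)))
        ; u≢α = λ n → x≢m (same-line σ xm I₁ I₂ n)
        ; α≢v = λ n → m≢y (same-line σ my I₃ I₄ n)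
        ; β≢γ = λ n → b≢b′ (same-point σ bb I₂ I₃ n)
        }
        where
        factor : ∀ u v α β γ D → u * β - α * β + (α * γ - v * γ) - D ≡ (u - α) * β + (α - v) * γ - D
        factor = solve-∀

      -- The ends have even distance, so they lie on one side σ. The first inner vertices are
      -- distinct neighbours of x and hence differ in their first coordinates, as `no-three-paths`
      -- demands.
      theta-free : (G : Graph) (ι : Fin (Graph.n G) → V) → (∀ {u v} → ι u ≡ ι v → u ≡ v) →
        (∀ {u v} → Edge G u v → Adjacent (ι u) (ι v)) → ThetaFree 3 4 G
      theta-free G ι ι-inj adjacent (x , y , W , W0 , W4 , edges , disjoint) =
        no-three-paths (P 0F) (P 1F) (P 2F) (β≢β 0F 1F λ ()) (β≢β 0F 2F λ ()) (β≢β 1F 2F λ ())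
        where
        σ : Bool
        σ = side (ι x)
        Inc : V → V → Set
        Inc = Incident (d₃ σ) (d₄ σ)
        e : ∀ i j → Adjacent _ _
        e i j = adjacent (edges i j)
        s₀ : ∀ i → side (ι (W i 0F)) ≡ σ
        s₀ i = cong (λ v → side (ι v)) (W0 i)
        s₁ : ∀ i → side (ι (W i 1F)) ≡ not σ
        s₁ i = proj₂ (oriented σ (e i 0F) (s₀ i))
        s₂ : ∀ i → side (ι (W i 2F)) ≡ σ
        s₂ i = trans (proj₂ (oriented (not σ) (e i 1F) (s₁ i))) (BoolP.not-involutive σ)
        s₃ : ∀ i → side (ι (W i 3F)) ≡ not σ
        s₃ i = proj₂ (oriented σ (e i 2F) (s₂ i))
        s₄ : ∀ i → side (ι (W i 4F)) ≡ σ
        s₄ i = trans (proj₂ (oriented (not σ) (e i 3F) (s₃ i))) (BoolP.not-involutive σ)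
        first : ∀ i → Inc (ι x) (ι (W i 1F))
        first i = subst (λ v → Inc (ι v) (ι (W i 1F))) (W0 i) (proj₁ (oriented σ (e i 0F) (s₀ i)))
        last : ∀ i → Inc (ι y) (ι (W i 3F))
        last i = subst (λ v → Inc (ι v) (ι (W i 3F))) (W4 i) (proj₁ (oriented σ (Adjacent-sym (e i 3F)) (s₄ i)))
        off-ends : ∀ {i i′ : Fin 3} → (i ≡ i′ × (Fin 5 ∋ 1F) ≡ 1F) ⊎ ((Fin 5 ∋ 1F) ≡ 0F × (Fin 5 ∋ 1F) ≡ 0F) ⊎ ((Fin 5 ∋ 1F) ≡ 4F × (Fin 5 ∋ 1F) ≡ 4F) → i ≡ i′
        off-ends (inj₁ (eq , _)) = eq
        off-ends (inj₂ (inj₁ (() , _)))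
        off-ends (inj₂ (inj₂ (() , _)))
        distinct₁ : ∀ {i} → W i 0F ≢ W i 2F
        distinct₁ {i} eq with disjoint i i 0F 2F eq
        ... | inj₁ (_ , ())
        ... | inj₂ (inj₁ (_ , ()))
        ... | inj₂ (inj₂ (() , _))
        distinct₂ : ∀ {i} → W i 2F ≢ W i 4F
        distinct₂ {i} eq with disjoint i i 2F 4F eq
        ... | inj₁ (_ , ())
        ... | inj₂ (inj₁ (() , _))
        ... | inj₂ (inj₂ (() , _))
        distinct₃ : ∀ {i} → W i 1F ≢ W i 3F
        distinct₃ {i} eq with disjoint i i 1F 3F eq
        ... | inj₁ (_ , ())
        ... | inj₂ (inj₁ (() , _))
        ... | inj₂ (inj₂ (() , _))
        P : ∀ i → Path (c₁ (ι x)) (c₁ (ι y)) (c₂ (ι x) - c₂ (ι y)) (d₃ σ (ι x) - d₃ σ (ι y)) (d₄ σ (ι x) - d₄ σ (ι y))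
                    (c₁ (ι (W i 2F))) (c₁ (ι (W i 1F))) (c₁ (ι (W i 3F)))
        P i = path σ (sym (s₂ i)) (trans (s₂ i) (trans (sym (s₄ i)) (cong (λ v → side (ι v)) (W4 i)))) (trans (s₁ i) (sym (s₃ i)))
          (first i) (proj₁ (oriented σ (Adjacent-sym (e i 1F)) (s₂ i))) (proj₁ (oriented σ (e i 2F) (s₂ i))) (last i)
          (λ eq → distinct₁ (trans (W0 i) (ι-inj eq))) (λ eq → distinct₂ (trans (ι-inj eq) (sym (W4 i)))) (λ eq → distinct₃ (ι-inj eq))
        β≢β : ∀ i i′ → i ≢ i′ → ¬ Null (c₁ (ι (W i 1F)) - c₁ (ι (W i′ 1F)))
        β≢β i i′ i≢i′ n = i≢i′ (off-ends (disjoint i i′ 1F 1F (ι-inj (same-point σ (trans (s₁ i) (sym (s₁ i′))) (first i) (first i′) n))))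

open Congruences
open import Data.Nat
open import Data.Nat.Properties
open import Data.Nat.DivMod using (m≡m%n+[m/n]*n; m%n<n; m/n*n≤m; m/n*n≡m; m*n/n≡m; /-monoˡ-≤; m≥n⇒m/n>0)
open import Data.Nat.Divisibility
open import Data.Nat.Primality
open import Data.Nat.Primality.Factorisation using (factorise; PrimeFactorisation)
open import Data.Nat.Coprimality using (Coprime; coprime-divisor)
open import Data.Nat.Combinatorics using (_C_; nC1≡n; nCk+nC[k+1]≡[n+1]C[k+1]; k![n∸k]!∣n!; nCk≡n!/k![n-k]!; k>n⇒nCk≡0)
open import Data.Nat.Induction using (<-rec)
open import Data.Nat.ListAction using (product)
open import Data.Nat.Tactic.RingSolver using (solve-∀)
open import Data.Integer as ℤ using (ℤ)
import Data.Integer.Properties as ℤP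
open import Data.Integer.DivMod using (_%ℕ_; _/ℕ_; a≡a%ℕn+[a/ℕn]*n; n%ℕd<d)
open import Data.Integer.Divisibility.Signed using (∣⇒∣ᵤ; divides) renaming (_∣_ to _∣ᶻ_)
import Data.Integer.Tactic.RingSolver as ℤSolver
open import Data.List using ([]; _∷_; length; filter; tabulate)
open import Data.List.Relation.Unary.All using ([]; _∷_)
open import Data.Vec using (Vec; []; _∷_; lookup; map)
open import Data.Vec.Functional using () renaming (_∷_ to _∷ᶠ_)
open import Data.Vec.Relation.Unary.All as All using (All; []; _∷_)
import Data.Vec.Relation.Unary.All.Properties as AllP
open import Data.Vec.Relation.Unary.AllPairs using ([]; _∷_)
open import Data.Vec.Relation.Unary.Unique.Propositional using (Unique)
open import Data.Vec.Relation.Unary.Unique.Propositional.Properties using (lookup-injective)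
open import Data.Product.Function.NonDependent.Propositional using (_×-↔_)
open import Data.Sum.Function.Propositional using (_⊎-↔_)
open import Function.Properties.Inverse using (↔-trans; ↔-refl)
import Algebra.Properties.CommutativeMonoid.Sum +-0-commutativeMonoid as Summation
open import Algebra.Properties.Semiring.Sum +-*-semiring using (*-distribˡ-sum)

-- Counting

𝟙 : {P : Set} → Dec P → ℕ
𝟙 (yes _) = 1
𝟙 (no _)  = 0

𝟙-mono : {P Q : Set} {p? : Dec P} {q? : Dec Q} → (P → Q) → 𝟙 p? ≤ 𝟙 q?
𝟙-mono {p? = no _}                _ = z≤n
𝟙-mono {p? = yes _} {q? = yes _}  _ = ≤-refl
𝟙-mono {p? = yes p} {q? = no ¬q} f = contradiction (f p) ¬q

𝟙≤1 : {P : Set} (p? : Dec P) → 𝟙 p? ≤ 1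
𝟙≤1 (yes _) = ≤-refl
𝟙≤1 (no _)  = z≤n

*-𝟙≤ : ∀ {P : Set} {c b} (p? : Dec P) → (P → c ≤ b) → c * 𝟙 p? ≤ b
*-𝟙≤ {c = c} (yes p) h = ≤-trans (≤-reflexive (*-identityʳ c)) (h p)
*-𝟙≤ {c = c} (no _)  _ = ≤-trans (≤-reflexive (*-zeroʳ c)) z≤n

𝟙-× : {P Q : Set} (p? : Dec P) (q? : Dec Q) → 𝟙 (p? ×-dec q?) ≡ 𝟙 p? * 𝟙 q?
𝟙-× (no _)  _       = refl
𝟙-× (yes _) (no _)  = refl
𝟙-× (yes _) (yes _) = refl

𝟙-true : {P : Set} {p? : Dec P} → P → 𝟙 p? ≡ 1
𝟙-true {p? = yes _} _ = refl
𝟙-true {p? = no ¬p} p = contradiction p ¬p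

opaque
  sum : ∀ {n} → (Fin n → ℕ) → ℕ
  sum = Summation.sum

opaque
  unfolding sum

  sum-cong : ∀ {n} {f g : Fin n → ℕ} → (∀ i → f i ≡ g i) → sum f ≡ sum g
  sum-cong = Summation.sum-cong-≗

  sum-+ : ∀ {n} (f g : Fin n → ℕ) → sum (λ i → f i + g i) ≡ sum f + sum g
  sum-+ = Summation.∑-distrib-+

  sum-* : ∀ {n} c (f : Fin n → ℕ) → c * sum f ≡ sum (λ i → c * f i)
  sum-* = *-distribˡ-sum

  sum-swap : ∀ {m n} (f : Fin m → Fin n → ℕ) → sum (λ i → sum (f i)) ≡ sum (λ j → sum (λ i → f i j))
  sum-swap = Summation.∑-comm

  sum-mono : ∀ {n} {f g : Fin n → ℕ} → (∀ i → f i ≤ g i) → sum f ≤ sum g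
  sum-mono {zero}  _ = z≤n
  sum-mono {suc n} h = +-mono-≤ (h zero) (sum-mono (h ∘ suc))

  term≤sum : ∀ {n} (f : Fin n → ℕ) i → f i ≤ sum f
  term≤sum f zero    = m≤m+n _ _
  term≤sum f (suc i) = ≤-trans (term≤sum (f ∘ suc) i) (m≤n+m _ (f zero))

  sum-zero : ∀ {n} {f : Fin n → ℕ} → (∀ i → f i ≡ 0) → sum f ≡ 0
  sum-zero {zero}  _ = refl
  sum-zero {suc n} h = cong₂ _+_ (h zero) (sum-zero (h ∘ suc))

  sum-const : ∀ n c → sum {n} (λ _ → c) ≡ n * c
  sum-const zero    c = refl
  sum-const (suc n) c = cong (c +_) (sum-const n c)

  sum-δ : ∀ {n} (u : Fin n) (f : Fin n → ℕ) → sum (λ i → 𝟙 (u ≟F i) * f i) ≡ f u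
  sum-δ {suc n} zero f =
    trans (cong₂ _+_ (+-identityʳ _) (sum-zero {n} (λ _ → refl))) (+-identityʳ _)
  sum-δ {suc n} (suc u) f = trans (sum-cong shift) (sum-δ u (f ∘ suc))
    where
    shift : ∀ i → 𝟙 (suc u ≟F suc i) * f (suc i) ≡ 𝟙 (u ≟F i) * f (suc i)
    shift i with u ≟F i
    ... | yes _ = refl
    ... | no _  = refl

sum-sum-mono : ∀ {m n} {f g : Fin m → Fin n → ℕ} → (∀ i j → f i j ≤ g i j) →
  sum (λ i → sum (f i)) ≤ sum (λ i → sum (g i))
sum-sum-mono h = sum-mono (λ i → sum-mono (h i))

sum-linear : ∀ {n} c (f g : Fin n → ℕ) → sum (λ i → f i + c * g i) ≡ sum f + c * sum g
sum-linear c f g = trans (sum-+ f (λ i → c * g i)) (cong (sum f +_) (sym (sum-* c g)))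

# : ∀ {n} {P : Fin n → Set} → (∀ i → Dec (P i)) → ℕ
# P? = sum (λ i → 𝟙 (P? i))

#-mono : ∀ {n} {P Q : Fin n → Set} {P? : ∀ i → Dec (P i)} {Q? : ∀ i → Dec (Q i)} →
  (∀ {i} → P i → Q i) → # P? ≤ # Q?
#-mono h = sum-mono (λ i → 𝟙-mono h)

#-∪ : ∀ {n} {P Q R : Fin n → Set} {P? : ∀ i → Dec (P i)} (Q? : ∀ i → Dec (Q i)) (R? : ∀ i → Dec (R i)) →
  (∀ {i} → P i → Q i ⊎ R i) → # P? ≤ # Q? + # R?
#-∪ {P? = P?} Q? R? h = ≤-trans (sum-mono pt) (≤-reflexive (sum-+ _ _))
  where
  pt : ∀ i → 𝟙 (P? i) ≤ 𝟙 (Q? i) + 𝟙 (R? i)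
  pt i with P? i
  ... | no _ = z≤n
  ... | yes p with h p
  ...   | inj₁ q = ≤-trans (≤-reflexive (sym (𝟙-true q))) (m≤m+n _ (𝟙 (R? i)))
  ...   | inj₂ r = ≤-trans (≤-reflexive (sym (𝟙-true r))) (m≤n+m _ (𝟙 (Q? i)))

#-none : ∀ {n} {P : Fin n → Set} {P? : ∀ i → Dec (P i)} → (∀ {i} → ¬ P i) → # P? ≡ 0
#-none {P? = P?} h = sum-zero (λ i → n≤0⇒n≡0 (𝟙-mono {p? = P? i} {q? = no id} h))

#-witness : ∀ {n} {P : Fin n → Set} (P? : ∀ i → Dec (P i)) → 0 < # P? → ∃ P
#-witness P? pos with FinP.any? P?
... | yes w = w
... | no ¬w = contradiction (#-none {P? = P?} (λ p → ¬w (_ , p))) (>⇒≢ pos)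

#≤n : ∀ {n} {P : Fin n → Set} (P? : ∀ i → Dec (P i)) → # P? ≤ n
#≤n {n} P? = subst (# P? ≤_) (trans (sum-const n 1) (*-identityʳ n))
  (sum-mono (λ i → 𝟙≤1 (P? i)))

#-≡ : ∀ {n} (u : Fin n) → # (u ≟F_) ≡ 1
#-≡ u = trans (sum-cong (λ i → sym (*-identityʳ (𝟙 (u ≟F i))))) (sum-δ u (λ _ → 1))

-- A forbidden colour removes at most M elements, so k of them cannot exhaust more than k M.
avoid : ∀ {n m} {P : Fin n → Set} (P? : ∀ i → Dec (P i)) (col : Fin n → Fin m) M →
  (∀ u → # (λ i → P? i ×-dec (col i ≟F u)) ≤ M) →
  ∀ {k} (X : Vec (Fin m) k) → k * M < # P? → ∃ λ i → P i × All (col i ≢_) X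
avoid P? col M few [] lt = let i , p = #-witness P? lt in i , p , []
avoid {P = P} P? col M few {suc k} (u ∷ X) lt =
  let i , (p , ne) , al = avoid P′? col M few′ X lt′ in i , p , ne ∷ al
  where
  P′? : ∀ i → Dec (P i × ¬ col i ≡ u)
  P′? i = P? i ×-dec ¬? (col i ≟F u)
  few′ : ∀ v → # (λ i → P′? i ×-dec (col i ≟F v)) ≤ M
  few′ v = ≤-trans (#-mono (λ ((p , _) , e) → p , e)) (few v)
  part : ∀ i → 𝟙 (P? i) ≤ 𝟙 (P? i ×-dec (col i ≟F u)) + 𝟙 (P′? i)
  part i with P? i | col i ≟F u
  ... | no _  | _     = z≤n
  ... | yes _ | yes _ = s≤s z≤n
  ... | yes _ | no _  = s≤s z≤n
  lt′ : k * M < # P′?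
  lt′ = +-cancelˡ-< M _ _ (<-≤-trans lt (≤-trans (sum-mono part)
    (≤-trans (≤-reflexive (sum-+ _ _)) (+-monoˡ-≤ _ (few u)))))

avoid-id : ∀ {n} {P : Fin n → Set} (P? : ∀ i → Dec (P i)) →
  ∀ {k} (X : Vec (Fin n) k) → k < # P? → ∃ λ i → P i × All (i ≢_) X
avoid-id P? {k} X lt = avoid P? id 1
  (λ u → ≤-trans (#-mono (λ (_ , e) → sym e)) (≤-reflexive (#-≡ u)))
  X (subst (_< # P?) (sym (*-identityʳ k)) lt)

## : ∀ {m n} {R : Fin m → Fin n → Set} → (∀ i j → Dec (R i j)) → ℕ
## R? = sum (λ i → # (R? i))

##-flip : ∀ {m n} {R : Fin m → Fin n → Set} (R? : ∀ i j → Dec (R i j)) → ## R? ≡ ## (flip R?)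
##-flip R? = sum-swap (λ i j → 𝟙 (R? i j))

##-mono : ∀ {m n} {R S : Fin m → Fin n → Set} {R? : ∀ i j → Dec (R i j)} {S? : ∀ i j → Dec (S i j)} →
  (∀ {i j} → R i j → S i j) → ## R? ≤ ## S?
##-mono h = sum-mono (λ i → #-mono h)

##-none : ∀ {m n} {R : Fin m → Fin n → Set} {R? : ∀ i j → Dec (R i j)} → (∀ {i j} → ¬ R i j) → ## R? ≡ 0
##-none {R? = R?} h = sum-zero (λ i → #-none {P? = R? i} h)

-- Row sizes are measured before pruning: an entry that survives several prunings has many partners
-- in each earlier relation, so a path can be grown through the relations in reverse order.
prune? : ∀ {m n} {R : Fin m → Fin n → Set} (R? : ∀ i j → Dec (R i j)) c →
  ∀ i j → Dec (R i j × c < # (R? i))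
prune? R? c i j = R? i j ×-dec (c <? # (R? i))

prune : ∀ {m n} {R : Fin m → Fin n → Set} (R? : ∀ i j → Dec (R i j)) c
  {A : Fin m → Set} (A? : ∀ i → Dec (A i)) → (∀ {i j} → R i j → A i) →
  ## R? ≤ ## (prune? R? c) + c * # A?
prune R? c A? sub = ≤-trans (sum-mono row) (≤-reflexive (sum-linear c _ _))
  where
  row : ∀ i → # (R? i) ≤ # (prune? R? c i) + c * 𝟙 (A? i)
  row i with c <? # (R? i) in eq | A? i
  ... | yes lt | _     = ≤-trans (#-mono (λ r → r , lt)) (m≤m+n _ _)
  ... | no ge  | yes _ = ≤-trans (≮⇒≥ ge) (≤-trans (≤-reflexive (sym (*-identityʳ c))) (m≤n+m _ _))
  ... | no _   | no ¬a = ≤-trans (≤-reflexive (#-none {P? = R? i} (λ r → ¬a (sub r)))) z≤n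

pruneᶜ : ∀ {m n} {R : Fin m → Fin n → Set} (R? : ∀ i j → Dec (R i j)) c
  {B : Fin n → Set} (B? : ∀ j → Dec (B j)) → (∀ {i j} → R i j → B j) →
  ## R? ≤ ## (flip (prune? (flip R?) c)) + c * # B?
pruneᶜ R? c B? sub = begin
  ## R?                                          ≡⟨ ##-flip R? ⟩
  ## (flip R?)                                   ≤⟨ prune (flip R?) c B? sub ⟩
  ## (prune? (flip R?) c) + c * # B?             ≡⟨ cong (_+ c * # B?) (##-flip (prune? (flip R?) c)) ⟩
  ## (flip (prune? (flip R?) c)) + c * # B?      ∎
  where open ≤-Reasoning

fibre-# : ∀ {n m} {A : Fin n → Set} (A? : ∀ i → Dec (A i)) (col : Fin n → Fin m) →
  sum (λ u → # (λ i → A? i ×-dec (col i ≟F u))) ≡ # A?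
fibre-# A? col = trans (sum-swap _) (sum-cong λ i → begin
  sum (λ u → 𝟙 (A? i ×-dec (col i ≟F u)))  ≡⟨ sum-cong (λ u → trans (𝟙-× (A? i) (col i ≟F u)) (*-comm (𝟙 (A? i)) _)) ⟩
  sum (λ u → 𝟙 (col i ≟F u) * 𝟙 (A? i))    ≡⟨ sum-δ (col i) (λ _ → 𝟙 (A? i)) ⟩
  𝟙 (A? i)                                   ∎)
  where open ≡-Reasoning

-- The bound is linear and every i, like every j, lies in one colour class only, so the bounds for
-- the classes add up.
colour-split : ∀ {n m} {R : Fin n → Fin n → Set} (R? : ∀ i j → Dec (R i j))
  {A B : Fin n → Set} (A? : ∀ i → Dec (A i)) (B? : ∀ i → Dec (B i)) (col χ : Fin n → Fin m) c →
  (∀ u → ## (λ i j → R? i j ×-dec ((col i ≟F u) ×-dec (χ j ≟F u)))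
         ≤ c * (# (λ i → A? i ×-dec (col i ≟F u)) + # (λ j → B? j ×-dec (χ j ≟F u)))) →
  ## (λ i j → R? i j ×-dec (col i ≟F χ j)) ≤ c * (# A? + # B?)
colour-split {n} {m} R? A? B? col χ c bound = begin
  ## (λ i j → R? i j ×-dec (col i ≟F χ j))                        ≤⟨ sum-sum-mono pt ⟩
  sum (λ i → sum (λ j → sum (λ u → 𝟙 (K? u i j))))              ≡⟨ sum-cong (λ i → sum-swap (λ j u → 𝟙 (K? u i j))) ⟩
  sum (λ i → sum (λ u → # (K? u i)))                             ≡⟨ sum-swap (λ i u → # (K? u i)) ⟩
  sum (λ u → ## (K? u))                                          ≤⟨ sum-mono bound ⟩
  sum (λ u → c * (# (A′? u) + # (B′? u)))                       ≡⟨ sum-* c (λ u → # (A′? u) + # (B′? u)) ⟨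
  c * sum (λ u → # (A′? u) + # (B′? u))                         ≡⟨ cong (c *_) (sum-+ (λ u → # (A′? u)) (λ u → # (B′? u))) ⟩
  c * (sum (λ u → # (A′? u)) + sum (λ u → # (B′? u)))           ≡⟨ cong (c *_) (cong₂ _+_ (fibre-# A? col) (fibre-# B? χ)) ⟩
  c * (# A? + # B?)                                              ∎
  where
  open ≤-Reasoning
  K? : ∀ u i j → Dec _
  K? u i j = R? i j ×-dec ((col i ≟F u) ×-dec (χ j ≟F u))
  A′? : ∀ u i → Dec _
  A′? u i = A? i ×-dec (col i ≟F u)
  B′? : ∀ u i → Dec _
  B′? u i = B? i ×-dec (χ i ≟F u)
  pt : ∀ i j → 𝟙 (R? i j ×-dec (col i ≟F χ j)) ≤ sum (λ u → 𝟙 (K? u i j))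
  pt i j = ≤-trans (𝟙-mono (λ (r , e) → r , refl , sym e)) (term≤sum _ (col i))

Spread : ∀ {n m} (R : Fin n → Fin n → Set) (col : Fin n → Fin m) (c : ℕ) → Fin n → Set
Spread {m = m} R col c b = ∀ {k} → k ≤ c → (X : Vec (Fin m) k) → ∃ λ a → R a b × All (col a ≢_) X

-- If each colour takes less than a fraction 1/c of the d entries of column b, it takes at most M =
-- (d - 1)/c of them, and c colours leave an entry over.
spread-or-concentrated : ∀ {n m} {R : Fin n → Fin n → Set} (R? : ∀ i j → Dec (R i j))
  (col : Fin n → Fin m) (u₀ : Fin m) c .{{_ : NonZero c}} b →
  (∃ λ u → # (λ a → R? a b) ≤ c * # (λ a → R? a b ×-dec (col a ≟F u))) ⊎ Spread R col c b
spread-or-concentrated R? col u₀ c b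
  with FinP.any? (λ u → # (λ a → R? a b) ≤? c * # (λ a → R? a b ×-dec (col a ≟F u)))
... | yes w = inj₁ w
... | no ¬w = inj₂ λ {k} k≤c X → avoid (λ a → R? a b) col M few X
      (≤-<-trans (*-monoˡ-≤ M k≤c) (≤-<-trans (≤-reflexive (*-comm c M)) (≤-<-trans (m/n*n≤m (d ∸ 1) c) d-1<d)))
  where
  d M : ℕ
  d = # (λ a → R? a b)
  M = (d ∸ 1) / c
  small : ∀ u → c * # (λ a → R? a b ×-dec (col a ≟F u)) < d
  small u = ≰⇒> (λ le → ¬w (u , le))
  d-1<d : d ∸ 1 < d
  -- The colour `u₀` is needed to see that the column is nonempty.
  d-1<d = ≤-reflexive (m+[n∸m]≡n {1} (≤-trans (s≤s z≤n) (small u₀)))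
  few : ∀ u → # (λ a → R? a b ×-dec (col a ≟F u)) ≤ M
  few u = subst (_≤ M) (m*n/n≡m _ c) (/-monoˡ-≤ c (≤-trans (≤-reflexive (*-comm _ c)) (∸-monoˡ-≤ 1 (small u))))

-- S is the set of spread columns; χ b is the dominant colour of any other column b.
concentrate : ∀ {n m} {R : Fin n → Fin n → Set} (R? : ∀ i j → Dec (R i j))
  (col : Fin n → Fin m) (dflt : Fin n → Fin m) c .{{_ : NonZero c}} →
  Σ (Fin n → Fin m) λ χ → Σ (Fin n → Set) λ S → Σ (∀ b → Dec (S b)) λ S? →
    (∀ {b} → S b → Spread R col c b) ×
    ## R? ≤ ## (λ a b → R? a b ×-dec S? b) + c * ## (λ a b → R? a b ×-dec (col a ≟F χ b))
concentrate {n} {m} {R} R? col dflt c = χ , S , S? , (λ {b} → spread {b}) , bound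
  where
  D : Fin n → Set
  D b = (∃ λ u → # (λ a → R? a b) ≤ c * # (λ a → R? a b ×-dec (col a ≟F u))) ⊎ Spread R col c b
  dich : ∀ b → D b
  dich b = spread-or-concentrated R? col (dflt b) c b
  χ′ : ∀ {b} → D b → Fin m
  χ′ (inj₁ (u , _)) = u
  χ′ {b} (inj₂ _)   = dflt b
  χ : Fin n → Fin m
  χ b = χ′ (dich b)
  S′ : ∀ {b} → D b → Set
  S′ (inj₁ _) = ⊥
  S′ (inj₂ _) = ⊤
  S : Fin n → Set
  S b = S′ (dich b)
  S? : ∀ b → Dec (S b)
  S? b with dich b
  ... | inj₁ _ = no id
  ... | inj₂ _ = yes tt
  spread : ∀ {b} → S b → Spread R col c b
  spread {b} s with dich b
  spread {b} () | inj₁ _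
  ... | inj₂ sp = sp
  column : ∀ b → # (λ a → R? a b) ≤ # (λ a → R? a b ×-dec S? b) + c * # (λ a → R? a b ×-dec (col a ≟F χ b))
  column b with dich b
  ... | inj₁ (u , le) = ≤-trans le (m≤n+m _ _)
  ... | inj₂ _        = ≤-trans (#-mono (λ r → r , tt)) (m≤m+n _ _)
  bound : ## R? ≤ ## (λ a b → R? a b ×-dec S? b) + c * ## (λ a b → R? a b ×-dec (col a ≟F χ b))
  bound = begin
    ## R?         ≡⟨ ##-flip R? ⟩
    ## (flip R?)  ≤⟨ sum-mono column ⟩
    _             ≡⟨ sum-linear c _ _ ⟩
    _             ≡⟨ cong₂ (λ p q → p + c * q) (##-flip (λ a b → R? a b ×-dec S? b)) (##-flip (λ a b → R? a b ×-dec (col a ≟F χ b))) ⟨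
    _             ∎
    where open ≤-Reasoning

#-unique : ∀ {n} {P : Fin n → Set} (P? : ∀ i → Dec (P i)) → (∀ {i j} → P i → P j → i ≡ j) → # P? ≤ 1
#-unique P? uniq with FinP.any? P?
... | yes (i , p) = ≤-trans (#-mono (uniq p)) (≤-reflexive (#-≡ i))
... | no none = ≤-trans (≤-reflexive (#-none {P? = P?} (λ p → none (_ , p)))) z≤n

#≤-injection : ∀ {n m} {P : Fin n → Set} (P? : ∀ i → Dec (P i)) (f : Fin n → Fin m) →
  (∀ {i j} → P i → P j → f i ≡ f j → i ≡ j) → # P? ≤ m
#≤-injection {m = m} P? f inj = begin
  # P?                                          ≡⟨ fibre-# P? f ⟨
  sum (λ u → # (λ i → P? i ×-dec (f i ≟F u)))  ≤⟨ sum-mono (λ u → #-unique _ λ (p , e) (q , e′) → inj p q (trans e (sym e′))) ⟩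
  sum {m} (λ _ → 1)                             ≡⟨ trans (sum-const m 1) (*-identityʳ m) ⟩
  m                                             ∎
  where open ≤-Reasoning

-- Finding theta graphs

-- Entry (i , j) is the index of the j-th vertex of the i-th path in the list of the 11 vertices of a θ₃,₄.
Layout : Set
Layout = Vec (Vec (Fin 11) 5) 3

place : Layout → Fin 3 → Fin 5 → Fin 11
place t i j = lookup (lookup t i) j

Valid : Layout → Set
Valid t =
  (∀ i → place t i zero ≡ place t zero zero) ×
  (∀ i → place t i (fromℕ 4) ≡ place t zero (fromℕ 4)) ×
  (∀ i i′ j j′ → place t i j ≡ place t i′ j′ →
      (i ≡ i′ × j ≡ j′) ⊎ (j ≡ zero × j′ ≡ zero) ⊎ (j ≡ fromℕ 4 × j′ ≡ fromℕ 4))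

valid? : ∀ t → Dec (Valid t)
valid? t =
  FinP.all? (λ i → _ ≟F _) ×-dec
  FinP.all? (λ i → _ ≟F _) ×-dec
  FinP.all? (λ i → FinP.all? λ i′ → FinP.all? λ j → FinP.all? λ j′ →
    (_ ≟F _) →-dec (((i ≟F i′) ×-dec (j ≟F j′)) ⊎-dec
      (((j ≟F zero) ×-dec (j′ ≟F zero)) ⊎-dec ((j ≟F fromℕ 4) ×-dec (j′ ≟F fromℕ 4)))))

module _ (G : Graph) where

  V : Set
  V = Fin (Graph.n G)

  E : V → V → Set
  E = Edge G

  E? : ∀ u v → Dec (E u v)
  E? u v = adj G u v BoolP.≟ true

  E-sym : ∀ {u v} → E u v → E v u
  E-sym {u} {v} e = trans (Graph.sym G v u) e

  E-irrefl : ∀ {u v} → E u v → u ≢ v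
  E-irrefl {u} e refl with trans (sym e) (loopless G u)
  ... | ()

  -- Disjointness of the paths is a finite fact about indices, found by evaluating `valid?`; it
  -- passes to vertices since the list has no repetitions.
  theta : ∀ t {_ : True (valid? t)} (L : Vec V 11) → Unique L →
    (∀ i (j : Fin 4) → E (lookup L (place t i (inject₁ j))) (lookup L (place t i (suc j)))) → ThetaCopy 3 4 G
  theta t {ok} L uniq edges =
    let starts , ends , inj = toWitness ok
    in lookup L (place t zero zero) , lookup L (place t zero (fromℕ 4)) ,
       (λ i j → lookup L (place t i j)) ,
       (λ i → cong (lookup L) (starts i)) ,
       (λ i → cong (lookup L) (ends i)) ,
       edges ,
       λ i i′ j j′ eq → inj i i′ j j′ (lookup-injective uniq _ _ eq)

  -- Used with f a colouring: if the colour of a avoids the colours of the used vertices, then so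
  -- does every vertex of the same colour, such as an ancestor of a, and all of these are new.
  map-≢ : ∀ (f : V → V) {a b k} {X : Vec V k} → f a ≡ f b → All (f b ≢_) (map f X) → All (a ≢_) X
  map-≢ f eq al = All.map (λ ne a≡v → ne (trans (sym eq) (cong f a≡v))) (AllP.map⁻ al)

  Pick : ℕ → (V → Set) → Set
  Pick m R = ∀ {k} → k ≤ m → (X : Vec V k) → ∃ λ v → R v × All (v ≢_) X

  -- The paths are x - c - b - a - y, chosen from y: first all a, then all b, then all c. The last
  -- choice of each kind has 4, 7, 10 vertices to avoid.
  theta₁ : ∀ {x y} {P Q : V → Set} → y ≢ x → Pick 4 (λ a → E a y × P a) →
    (∀ {a} → P a → Pick 7 (λ b → E a b × Q b)) → (∀ {b} → Q b → Pick 10 (λ c → E x c × E c b)) → ThetaCopy 3 4 G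
  theta₁ {x} {y} y≢x step₁ step₂ step₃
    with step₁ (from-yes (2 ≤? 4)) (y ∷ x ∷ [])
  ... | a₁ , (ya₁ , r₁) , A₁
    with step₁ (from-yes (3 ≤? 4)) (a₁ ∷ y ∷ x ∷ [])
  ... | a₂ , (ya₂ , r₂) , A₂
    with step₁ (from-yes (4 ≤? 4)) (a₂ ∷ a₁ ∷ y ∷ x ∷ [])
  ... | a₃ , (ya₃ , r₃) , A₃
    with step₂ r₁ (from-yes (5 ≤? 7)) (a₃ ∷ a₂ ∷ a₁ ∷ y ∷ x ∷ [])
  ... | b₁ , (ab₁ , s₁) , B₁
    with step₂ r₂ (from-yes (6 ≤? 7)) (b₁ ∷ a₃ ∷ a₂ ∷ a₁ ∷ y ∷ x ∷ [])
  ... | b₂ , (ab₂ , s₂) , B₂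
    with step₂ r₃ (from-yes (7 ≤? 7)) (b₂ ∷ b₁ ∷ a₃ ∷ a₂ ∷ a₁ ∷ y ∷ x ∷ [])
  ... | b₃ , (ab₃ , s₃) , B₃
    with step₃ s₁ (from-yes (8 ≤? 10)) (b₃ ∷ b₂ ∷ b₁ ∷ a₃ ∷ a₂ ∷ a₁ ∷ y ∷ x ∷ [])
  ... | c₁ , (xc₁ , cb₁) , C₁
    with step₃ s₂ (from-yes (9 ≤? 10)) (c₁ ∷ b₃ ∷ b₂ ∷ b₁ ∷ a₃ ∷ a₂ ∷ a₁ ∷ y ∷ x ∷ [])
  ... | c₂ , (xc₂ , cb₂) , C₂
    with step₃ s₃ (from-yes (10 ≤? 10)) (c₂ ∷ c₁ ∷ b₃ ∷ b₂ ∷ b₁ ∷ a₃ ∷ a₂ ∷ a₁ ∷ y ∷ x ∷ [])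
  ... | c₃ , (xc₃ , cb₃) , C₃ = theta
        -- The list is in reverse order of choice, so x has index 10 and y index 9.
        ((suc 9F ∷ 2F ∷ 5F ∷ 8F ∷ 9F ∷ []) ∷
         (suc 9F ∷ 1F ∷ 4F ∷ 7F ∷ 9F ∷ []) ∷
         (suc 9F ∷ 0F ∷ 3F ∷ 6F ∷ 9F ∷ []) ∷ [])
        (c₃ ∷ c₂ ∷ c₁ ∷ b₃ ∷ b₂ ∷ b₁ ∷ a₃ ∷ a₂ ∷ a₁ ∷ y ∷ x ∷ [])
        (C₃ ∷ C₂ ∷ C₁ ∷ B₃ ∷ B₂ ∷ B₁ ∷ A₃ ∷ A₂ ∷ A₁ ∷ (y≢x ∷ []) ∷ [] ∷ [])
        (λ { 0F 0F → xc₁ ; 0F 1F → cb₁ ; 0F 2F → E-sym ab₁ ; 0F 3F → ya₁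
           ; 1F 0F → xc₂ ; 1F 1F → cb₂ ; 1F 2F → E-sym ab₂ ; 1F 3F → ya₂
           ; 2F 0F → xc₃ ; 2F 1F → cb₃ ; 2F 2F → E-sym ab₃ ; 2F 3F → ya₃ })

  -- The paths are x - col a - a - b - y. A choice of a places two vertices, so 9 vertices precede
  -- the last choice.
  theta₂ : ∀ {x y} {S : V → Set} (col : V → V) → y ≢ x → Pick 4 (λ b → E y b × S b) →
    (∀ {b} → S b → ∀ {k} → k ≤ 9 → (X : Vec V k) →
      ∃ λ a → (E x (col a) × E (col a) a × E a b) × All (col a ≢_) X × All (a ≢_) (col a ∷ X)) → ThetaCopy 3 4 G
  theta₂ {x} {y} col y≢x step₁ step₂
    with step₁ (from-yes (2 ≤? 4)) (y ∷ x ∷ [])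
  ... | b₁ , (h₁ , s₁) , B₁
    with step₁ (from-yes (3 ≤? 4)) (b₁ ∷ y ∷ x ∷ [])
  ... | b₂ , (h₂ , s₂) , B₂
    with step₁ (from-yes (4 ≤? 4)) (b₂ ∷ b₁ ∷ y ∷ x ∷ [])
  ... | b₃ , (h₃ , s₃) , B₃
    with step₂ s₁ (from-yes (5 ≤? 9)) (b₃ ∷ b₂ ∷ b₁ ∷ y ∷ x ∷ [])
  ... | a₁ , (u₁ , v₁ , w₁) , C₁ , A₁
    with step₂ s₂ (from-yes (7 ≤? 9)) (a₁ ∷ col a₁ ∷ b₃ ∷ b₂ ∷ b₁ ∷ y ∷ x ∷ [])
  ... | a₂ , (u₂ , v₂ , w₂) , C₂ , A₂
    with step₂ s₃ (from-yes (9 ≤? 9)) (a₂ ∷ col a₂ ∷ a₁ ∷ col a₁ ∷ b₃ ∷ b₂ ∷ b₁ ∷ y ∷ x ∷ [])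
  ... | a₃ , (u₃ , v₃ , w₃) , C₃ , A₃ = theta
        ((suc 9F ∷ 5F ∷ 4F ∷ 8F ∷ 9F ∷ []) ∷
         (suc 9F ∷ 3F ∷ 2F ∷ 7F ∷ 9F ∷ []) ∷
         (suc 9F ∷ 1F ∷ 0F ∷ 6F ∷ 9F ∷ []) ∷ [])
        (a₃ ∷ col a₃ ∷ a₂ ∷ col a₂ ∷ a₁ ∷ col a₁ ∷ b₃ ∷ b₂ ∷ b₁ ∷ y ∷ x ∷ [])
        (A₃ ∷ C₃ ∷ A₂ ∷ C₂ ∷ A₁ ∷ C₁ ∷ B₃ ∷ B₂ ∷ B₁ ∷ (y≢x ∷ []) ∷ [] ∷ [])
        (λ { 0F 0F → u₁ ; 0F 1F → v₁ ; 0F 2F → w₁ ; 0F 3F → E-sym h₁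
           ; 1F 0F → u₂ ; 1F 1F → v₂ ; 1F 2F → w₂ ; 1F 3F → E-sym h₂
           ; 2F 0F → u₃ ; 2F 1F → v₃ ; 2F 2F → w₃ ; 2F 3F → E-sym h₃ })

  -- The paths are x - col₁ a - col₂ a - a - y. Each choice of a completes a path; x, y and two
  -- paths make 8 vertices before the last choice.
  theta₃ : ∀ {x y} (col₁ col₂ : V → V) → y ≢ x →
    (∀ {k} → k ≤ 8 → (X : Vec V k) →
      ∃ λ a → (E x (col₁ a) × E (col₁ a) (col₂ a) × E (col₂ a) a × E a y) ×
        All (col₁ a ≢_) X × All (col₂ a ≢_) (col₁ a ∷ X) × All (a ≢_) (col₂ a ∷ col₁ a ∷ X)) → ThetaCopy 3 4 G
  theta₃ {x} {y} col₁ col₂ y≢x step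
    with step (from-yes (2 ≤? 8)) (y ∷ x ∷ [])
  ... | a₁ , (u₁ , v₁ , w₁ , h₁) , C₁ , D₁ , A₁
    with step (from-yes (5 ≤? 8)) (a₁ ∷ col₂ a₁ ∷ col₁ a₁ ∷ y ∷ x ∷ [])
  ... | a₂ , (u₂ , v₂ , w₂ , h₂) , C₂ , D₂ , A₂
    with step (from-yes (8 ≤? 8)) (a₂ ∷ col₂ a₂ ∷ col₁ a₂ ∷ a₁ ∷ col₂ a₁ ∷ col₁ a₁ ∷ y ∷ x ∷ [])
  ... | a₃ , (u₃ , v₃ , w₃ , h₃) , C₃ , D₃ , A₃ = theta
        ((suc 9F ∷ 8F ∷ 7F ∷ 6F ∷ 9F ∷ []) ∷
         (suc 9F ∷ 5F ∷ 4F ∷ 3F ∷ 9F ∷ []) ∷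
         (suc 9F ∷ 2F ∷ 1F ∷ 0F ∷ 9F ∷ []) ∷ [])
        (a₃ ∷ col₂ a₃ ∷ col₁ a₃ ∷ a₂ ∷ col₂ a₂ ∷ col₁ a₂ ∷ a₁ ∷ col₂ a₁ ∷ col₁ a₁ ∷ y ∷ x ∷ [])
        (A₃ ∷ D₃ ∷ C₃ ∷ A₂ ∷ D₂ ∷ C₂ ∷ A₁ ∷ D₁ ∷ C₁ ∷ (y≢x ∷ []) ∷ [] ∷ [])
        (λ { 0F 0F → u₁ ; 0F 1F → v₁ ; 0F 2F → w₁ ; 0F 3F → h₁
           ; 1F 0F → u₂ ; 1F 1F → v₂ ; 1F 2F → w₂ ; 1F 3F → h₂
           ; 2F 0F → u₃ ; 2F 1F → v₃ ; 2F 2F → w₃ ; 2F 3F → h₃ })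

  module _ (free : ThetaFree 3 4 G) where

    module _ {H : V → V → Set} (H? : ∀ a b → Dec (H a b))
             {A B : V → Set} (A? : ∀ a → Dec (A a)) (B? : ∀ b → Dec (B b))
             (H⊆A : ∀ {a b} → H a b → A a) (H⊆B : ∀ {a b} → H a b → B b)
             (H⊆E : ∀ {a b} → H a b → E a b) where

      -- An entry surviving all prunings would give a y rich in `H₂?`, whose partners are rich in
      -- `H₁?`, whose partners are rich in `H?`: the input of `theta₁`. The cost is 10 + 4 per
      -- element of B and 7, rounded up to 14, per element of A.
      level₁ : ∀ x → (∀ {a b} → H a b → E x a) → (∀ {a b} → H a b → b ≢ x) →
        ## H? ≤ 14 * (# A? + # B?)
      level₁ x parent x∉B = begin
        ## H?                                  ≤⟨ pruneᶜ H? 10 B? H⊆B ⟩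
        ## H₁? + 10 * # B?                     ≤⟨ +-monoˡ-≤ _ (prune H₁? 7 A? (H⊆A ∘ proj₁)) ⟩
        ## H₂? + 7 * # A? + 10 * # B?          ≤⟨ +-monoˡ-≤ _ (+-monoˡ-≤ _ (pruneᶜ H₂? 4 B? (H⊆B ∘ proj₁ ∘ proj₁))) ⟩
        ## H₃? + 4 * # B? + 7 * # A? + 10 * # B?
          ≡⟨ cong (λ z → z + 4 * # B? + 7 * # A? + 10 * # B?) (##-none {R? = H₃?} (λ h → free (copy h))) ⟩
        4 * # B? + 7 * # A? + 10 * # B?        ≤⟨ m≤m+n _ (7 * # A?) ⟩
        4 * # B? + 7 * # A? + 10 * # B? + 7 * # A?  ≡⟨ arith (# A?) (# B?) ⟩
        14 * (# A? + # B?)                     ∎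
        where
        open ≤-Reasoning
        arith : ∀ a b → 4 * b + 7 * a + 10 * b + 7 * a ≡ 14 * (a + b)
        arith = solve-∀
        H₁? = flip (prune? (flip H?) 10)
        H₂? = prune? H₁? 7
        H₃? = flip (prune? (flip H₂?) 4)
        copy : ∀ {a₀ y} → ((H a₀ y × 10 < # (flip H? y)) × 7 < # (H₁? a₀)) × 4 < # (flip H₂? y) → ThetaCopy 3 4 G
        copy {y = y} (((h₀ , _) , _) , y-rich) = theta₁ {P = λ a → 7 < # (H₁? a)} {Q = λ b → 10 < # (flip H? b)} (x∉B h₀)
          (λ k≤ X → let a , ((h , _) , lt) , al = avoid-id (flip H₂? y) X (≤-<-trans k≤ y-rich) in a , (H⊆E h , lt) , al)
          (λ lt k≤ X → let b , (h , lt′) , al = avoid-id (H₁? _) X (≤-<-trans k≤ lt) in b , (H⊆E h , lt′) , al)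
          (λ lt k≤ X → let c , h , al = avoid-id (flip H? _) X (≤-<-trans k≤ lt) in c , (parent h , H⊆E h) , al)

    module _ {H : V → V → Set} (H? : ∀ a b → Dec (H a b))
             {A B : V → Set} (A? : ∀ a → Dec (A a)) (B? : ∀ b → Dec (B b))
             (H⊆A : ∀ {a b} → H a b → A a) (H⊆B : ∀ {a b} → H a b → B b)
             (H⊆E : ∀ {a b} → H a b → E a b) where

      -- A vertex y of A with more than 4 spread neighbours would end a `theta₂`, so spread columns
      -- cost 4 per element of A. In the rest the colours match, and for each colour u `level₁`
      -- applies with root u. In total 4 + 9 · 14 = 130.
      level₂ : ∀ x (col : V → V) →
        (∀ {a b} → H a b → E x (col a)) → (∀ {a b} → H a b → E (col a) a) → (∀ {a b} → H a b → col (col a) ≡ col a) →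
        (∀ {a b} → H a b → a ≢ x) → (∀ {a b} → H a b → b ≢ col a) →
        ## H? ≤ 130 * (# A? + # B?)
      level₂ x col root parent idem x∉A col∉B = begin
        ## H?                                   ≤⟨ bound ⟩
        ## HS? + 9 * ## (λ a b → H? a b ×-dec (col a ≟F χ b))
          ≤⟨ +-mono-≤ (prune HS? 4 A? (H⊆A ∘ proj₁)) (*-monoʳ-≤ 9 (colour-split H? A? B? col χ 14 below)) ⟩
        ## HS′? + 4 * # A? + 9 * (14 * (# A? + # B?))
          ≡⟨ cong (λ z → z + 4 * # A? + 9 * (14 * (# A? + # B?))) (##-none {R? = HS′?} (λ h → free (copy h))) ⟩
        4 * # A? + 9 * (14 * (# A? + # B?))     ≤⟨ m≤m+n _ (4 * # B?) ⟩
        4 * # A? + 9 * (14 * (# A? + # B?)) + 4 * # B?  ≡⟨ arith (# A?) (# B?) ⟩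
        130 * (# A? + # B?)                     ∎
        where
        open ≤-Reasoning
        arith : ∀ a b → 4 * a + 9 * (14 * (a + b)) + 4 * b ≡ 130 * (a + b)
        arith = solve-∀
        conc = concentrate H? col id 9
        χ = proj₁ conc
        S? = proj₁ (proj₂ (proj₂ conc))
        spread = proj₁ (proj₂ (proj₂ (proj₂ conc)))
        bound = proj₂ (proj₂ (proj₂ (proj₂ conc)))
        HS? = λ a b → H? a b ×-dec S? b
        HS′? = prune? HS? 4
        below : ∀ u → ## (λ a b → H? a b ×-dec ((col a ≟F u) ×-dec (χ b ≟F u)))
                      ≤ 14 * (# (λ a → A? a ×-dec (col a ≟F u)) + # (λ b → B? b ×-dec (χ b ≟F u)))
        below u = level₁ (λ a b → H? a b ×-dec ((col a ≟F u) ×-dec (χ b ≟F u)))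
          (λ a → A? a ×-dec (col a ≟F u)) (λ b → B? b ×-dec (χ b ≟F u))
          (λ (h , e , _) → H⊆A h , e) (λ (h , _ , e) → H⊆B h , e) (λ (h , _) → H⊆E h)
          u (λ { (h , refl , _) → parent h }) (λ { (h , refl , _) → col∉B h })
        copy : ∀ {y b₀} → (H y b₀ × proj₁ (proj₂ conc) b₀) × 4 < # (HS? y) → ThetaCopy 3 4 G
        copy {y = y} ((h₀ , _) , y-rich) = theta₂ {S = proj₁ (proj₂ conc)} col (x∉A h₀)
          (λ k≤ X → let b , (h , s) , al = avoid-id (HS? y) X (≤-<-trans k≤ y-rich) in b , (H⊆E h , s) , al)
          (λ s k≤ X → let a , h , al = spread s k≤ (map col X)
            in a , (root h , parent h , H⊆E h) , map-≢ col (idem h) al , (E-irrefl (parent h) ∘ sym) ∷ map-≢ col refl al)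

    module _ {H : V → V → Set} (H? : ∀ a b → Dec (H a b))
             {A B : V → Set} (A? : ∀ a → Dec (A a)) (B? : ∀ b → Dec (B b))
             (H⊆A : ∀ {a b} → H a b → A a) (H⊆B : ∀ {a b} → H a b → B b)
             (H⊆E : ∀ {a b} → H a b → E a b) where

      -- A single entry in a spread column gives a `theta₃`, so there is none. For matching colours
      -- u, `level₂` applies with root u and parents `col₂`; 8 · 130 = 1040.
      level₃ : ∀ x (col₁ col₂ : V → V) →
        (∀ {a b} → H a b → E x (col₁ a)) → (∀ {a b} → H a b → E (col₁ a) (col₂ a)) → (∀ {a b} → H a b → E (col₂ a) a) →
        (∀ {a b} → H a b → col₁ (col₁ a) ≡ col₁ a) → (∀ {a b} → H a b → col₁ (col₂ a) ≡ col₁ a) →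
        (∀ {a b} → H a b → col₂ (col₂ a) ≡ col₂ a) →
        (∀ {a b} → H a b → a ≢ col₁ a) → (∀ {a b} → H a b → b ≢ x) → (∀ {a b} → H a b → b ≢ col₂ a) →
        ## H? ≤ 1040 * (# A? + # B?)
      level₃ x col₁ col₂ root parent₁ parent₂ idem₁₁ idem₁₂ idem₂₂ col₁∉A x∉B col₂∉B = begin
        ## H?                                   ≤⟨ bound ⟩
        ## HS? + 8 * ## (λ a b → H? a b ×-dec (col₁ a ≟F χ b))
          ≤⟨ +-monoʳ-≤ (## HS?) (*-monoʳ-≤ 8 (colour-split H? A? B? col₁ χ 130 below)) ⟩
        ## HS? + 8 * (130 * (# A? + # B?))
          ≡⟨ cong (λ z → z + 8 * (130 * (# A? + # B?))) (##-none {R? = HS?} (λ h → free (copy h))) ⟩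
        8 * (130 * (# A? + # B?))               ≡⟨ *-assoc 8 130 (# A? + # B?) ⟨
        1040 * (# A? + # B?)                    ∎
        where
        open ≤-Reasoning
        conc = concentrate H? col₁ id 8
        χ = proj₁ conc
        S? = proj₁ (proj₂ (proj₂ conc))
        spread = proj₁ (proj₂ (proj₂ (proj₂ conc)))
        bound = proj₂ (proj₂ (proj₂ (proj₂ conc)))
        HS? = λ a b → H? a b ×-dec S? b
        below : ∀ u → ## (λ a b → H? a b ×-dec ((col₁ a ≟F u) ×-dec (χ b ≟F u)))
                      ≤ 130 * (# (λ a → A? a ×-dec (col₁ a ≟F u)) + # (λ b → B? b ×-dec (χ b ≟F u)))
        below u = level₂ (λ a b → H? a b ×-dec ((col₁ a ≟F u) ×-dec (χ b ≟F u)))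
          (λ a → A? a ×-dec (col₁ a ≟F u)) (λ b → B? b ×-dec (χ b ≟F u))
          (λ (h , e , _) → H⊆A h , e) (λ (h , _ , e) → H⊆B h , e) (λ (h , _) → H⊆E h)
          u col₂ (λ { (h , refl , _) → parent₁ h }) (λ (h , _) → parent₂ h) (λ (h , _) → idem₂₂ h)
          (λ { (h , refl , _) → col₁∉A h }) (λ (h , _) → col₂∉B h)
        copy : ∀ {a₀ y} → H a₀ y × proj₁ (proj₂ conc) y → ThetaCopy 3 4 G
        copy (h₀ , s) = theta₃ col₁ col₂ (x∉B h₀)
          (λ k≤ X → let a , h , al = spread s k≤ (map col₁ X)
            in a , (root h , parent₁ h , parent₂ h , H⊆E h) , map-≢ col₁ (idem₁₁ h) al ,
               ((E-irrefl (parent₁ h) ∘ sym) ∷ map-≢ col₁ (idem₁₂ h) al) ,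
               ((E-irrefl (parent₂ h) ∘ sym) ∷ col₁∉A h ∷ map-≢ col₁ refl al))

-- Distance levels

-- lev is the distance from x, truncated: all vertices further away than k have level suc k.
record Layering {n} (F : Fin n → Fin n → Set) (x : Fin n) (k : ℕ) : Set where
  field
    lev     : Fin n → ℕ
    root    : lev x ≡ 0
    root!   : ∀ {v} → lev v ≡ 0 → v ≡ x
    parent  : ∀ {v j} → j < k → lev v ≡ suc j → ∃ λ u → F u v × lev u ≡ j
    step    : ∀ {u v} → F u v → lev u < k → lev v ≤ suc (lev u)
    bounded : ∀ v → lev v ≤ suc k

-- The top level `suc k` lumps together all vertices beyond distance k. To go one step further,
-- those without a neighbour on level k are moved up by one.
layering : ∀ {n} {F : Fin n → Fin n → Set} (F? : ∀ u v → Dec (F u v)) x k → Layering F x k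
layering {n} F? x zero = record
  { lev = λ v → lv (v ≟F x) ; root = root ; root! = λ {v} → root! (v ≟F x)
  ; parent = λ () ; step = λ _ () ; bounded = λ v → bdd (v ≟F x) }
  where
  lv : ∀ {P : Set} → Dec P → ℕ
  lv (yes _) = 0
  lv (no _)  = 1
  root : lv (x ≟F x) ≡ 0
  root with x ≟F x
  ... | yes _ = refl
  ... | no ne = contradiction refl ne
  root! : ∀ {P : Set} (d : Dec P) → lv d ≡ 0 → P
  root! (yes p) _ = p
  bdd : ∀ {P : Set} (d : Dec P) → lv d ≤ 1
  bdd (yes _) = z≤n
  bdd (no _)  = ≤-refl
layering {n} {F} F? x (suc k) = record
  { lev = lev ; root = trans (keep (<⇒≢ z<s ∘ trans (sym L.root))) L.root ; root! = root!
  ; parent = parent ; step = step ; bounded = bounded }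
  where
  module L = Layering (layering F? x k)
  Far : Fin n → Set
  Far v = L.lev v ≡ suc k × ¬ ∃ λ u → F u v × L.lev u ≡ k
  far? : ∀ v → Dec (Far v)
  far? v = (L.lev v ≟ suc k) ×-dec ¬? (FinP.any? λ u → F? u v ×-dec (L.lev u ≟ k))
  lev : Fin n → ℕ
  lev v with far? v
  ... | yes _ = suc (suc k)
  ... | no _  = L.lev v
  keep′ : ∀ {v} → ¬ Far v → lev v ≡ L.lev v
  keep′ {v} near with far? v
  ... | yes far = contradiction far near
  ... | no _    = refl
  keep : ∀ {v} → L.lev v ≢ suc k → lev v ≡ L.lev v
  keep ne = keep′ (ne ∘ proj₁)
  cases : ∀ v → (Far v × lev v ≡ suc (suc k)) ⊎ (¬ Far v × lev v ≡ L.lev v)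
  cases v with far? v
  ... | yes far = inj₁ (far , refl)
  ... | no near = inj₂ (near , refl)
  root! : ∀ {v} → lev v ≡ 0 → v ≡ x
  root! {v} e with cases v
  ... | inj₁ (_ , e′) = contradiction (trans (sym e′) e) λ ()
  ... | inj₂ (_ , e′) = L.root! (trans (sym e′) e)
  bounded : ∀ v → lev v ≤ suc (suc k)
  bounded v with cases v
  ... | inj₁ (_ , e) = ≤-reflexive e
  ... | inj₂ (_ , e) = ≤-trans (≤-reflexive e) (m≤n⇒m≤1+n (L.bounded v))
  near⇒parent : ∀ {v} → ¬ Far v → L.lev v ≡ suc k → ∃ λ u → F u v × L.lev u ≡ k
  near⇒parent {v} near e with FinP.any? (λ u → F? u v ×-dec (L.lev u ≟ k))
  ... | yes w = w
  ... | no ¬w = contradiction (e , ¬w) near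
  old-parent : ∀ {v j} → j < suc k → L.lev v ≡ suc j → ¬ Far v → ∃ λ u → F u v × L.lev u ≡ j
  old-parent j<1+k e near with m≤n⇒m<n∨m≡n (s≤s⁻¹ j<1+k)
  ... | inj₁ j<k  = L.parent j<k e
  ... | inj₂ refl = near⇒parent near e
  parent : ∀ {v j} → j < suc k → lev v ≡ suc j → ∃ λ u → F u v × lev u ≡ j
  parent {v} {j} j<1+k e with cases v
  ... | inj₁ (_ , e′) = contradiction j<1+k (≤⇒≯ (≤-reflexive (suc-injective (trans (sym e′) e))))
  ... | inj₂ (near , e′) =
    let u , f , eᵤ = old-parent j<1+k (trans (sym e′) e) near
    in u , f , trans (keep (λ e″ → <⇒≢ j<1+k (trans (sym eᵤ) e″))) eᵤ
  step : ∀ {u v} → F u v → lev u < suc k → lev v ≤ suc (lev u)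
  step {u} {v} f lt with cases u
  ... | inj₁ (_ , e) = contradiction lt (≤⇒≯ (≤-trans (n≤1+n _) (≤-reflexive (sym e))))
  ... | inj₂ (_ , e) rewrite e with m≤n⇒m<n∨m≡n (s≤s⁻¹ lt)
  ...   | inj₁ lt′ = ≤-trans (≤-reflexive (keep (<⇒≢ (≤-<-trans (L.step f lt′) (s≤s lt′))))) (L.step f lt′)
  ...   | inj₂ eq = ≤-trans (≤-reflexive (keep′ (λ (_ , none) → none (u , f , eq)))) (≤-trans (L.bounded v) (≤-reflexive (cong suc (sym eq))))

-- Subgraphs of large minimum degree

module _ {n} {E : Fin n → Fin n → Set} (E? : ∀ u v → Dec (E u v)) (E-sym : ∀ {u v} → E u v → E v u) where

  Within : (Fin n → Set) → Fin n → Fin n → Set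
  Within S u v = E u v × S u × S v

  within? : ∀ {S : Fin n → Set} (S? : ∀ v → Dec (S v)) u v → Dec (Within S u v)
  within? S? u v = E? u v ×-dec (S? u ×-dec S? v)

  -- Deleting a vertex of degree below d loses at most 2 d ordered pairs, so the density hypothesis
  -- survives; m bounds the number of deletions.
  min-degree-subset : ∀ d m {S : Fin n → Set} (S? : ∀ v → Dec (S v)) → # S? ≤ m →
    2 * d * # S? < ## (within? S?) →
    Σ (Fin n → Set) λ T → Σ (∀ v → Dec (T v)) λ T? → ∃ T × (∀ {v} → T v → d ≤ # (within? T? v))
  min-degree-subset d m {S} S? #S≤m dense
    with FinP.any? (λ v → S? v ×-dec (# (within? S? v) <? d))
  ... | no none = S , S? , nonempty , λ {v} s → ≮⇒≥ (λ lt → none (v , s , lt))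
    where
    nonempty : ∃ S
    nonempty with FinP.any? S?
    ... | yes w = w
    ... | no ¬w = contradiction (##-none {R? = within? S?} (λ (_ , s , _) → ¬w (_ , s))) (>⇒≢ (≤-<-trans z≤n dense))
  min-degree-subset d zero {S} S? #S≤0 dense | yes (v , s , _) =
    contradiction (≤-trans (≤-reflexive (sym (𝟙-true {p? = S? v} s))) (≤-trans (term≤sum _ v) #S≤0)) λ ()
  min-degree-subset d (suc m) {S} S? #S≤1+m dense | yes (v , s , low) =
    min-degree-subset d m T? (s≤s⁻¹ (≤-trans smaller #S≤1+m)) dense′
    where
    T? : ∀ u → Dec (S u × v ≢ u)
    T? u = S? u ×-dec ¬? (v ≟F u)
    smaller : suc (# T?) ≤ # S?
    smaller = begin
      1 + # T?                          ≡⟨ cong (_+ # T?) (#-≡ v) ⟨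
      # (v ≟F_) + # T?                  ≡⟨ sum-+ _ _ ⟨
      sum (λ u → 𝟙 (v ≟F u) + 𝟙 (T? u)) ≤⟨ sum-mono pt ⟩
      # S?                              ∎
      where
      open ≤-Reasoning
      pt : ∀ u → 𝟙 (v ≟F u) + 𝟙 (T? u) ≤ 𝟙 (S? u)
      pt u with v ≟F u | S? u
      ... | yes refl | yes _ = ≤-refl
      ... | yes refl | no ¬s = contradiction s ¬s
      ... | no _     | yes _ = ≤-refl
      ... | no _     | no _  = z≤n
    deg : ℕ
    deg = # (within? S? v)
    -- The pairs through v form its row and its column, of equal size by symmetry.
    lost : ## (within? S?) ≤ ## (within? T?) + (deg + deg)
    lost = begin
      ## (within? S?)
        ≤⟨ sum-sum-mono pt ⟩
      sum (λ u → sum (λ w → 𝟙 (within? T? u w) + (𝟙 (v ≟F u) * 𝟙 (within? S? v w) + 𝟙 (v ≟F w) * 𝟙 (within? S? v u))))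
        ≡⟨ sum-cong (λ u → trans (sum-+ _ _) (cong (# (within? T? u) +_) (trans (sum-+ _ _)
             (cong₂ _+_ (sym (sum-* (𝟙 (v ≟F u)) _)) (sum-δ v (λ _ → 𝟙 (within? S? v u))))))) ⟩
      sum (λ u → # (within? T? u) + (𝟙 (v ≟F u) * deg + 𝟙 (within? S? v u)))
        ≡⟨ trans (sum-+ _ _) (cong (## (within? T?) +_) (trans (sum-+ _ _) (cong (_+ deg) (sum-δ v (λ _ → deg))))) ⟩
      ## (within? T?) + (deg + deg) ∎
      where
      open ≤-Reasoning
      pt : ∀ u w → 𝟙 (within? S? u w) ≤
        𝟙 (within? T? u w) + (𝟙 (v ≟F u) * 𝟙 (within? S? v w) + 𝟙 (v ≟F w) * 𝟙 (within? S? v u))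
      pt u w with v ≟F u
      ... | yes refl = ≤-trans (≤-trans (m≤m+n _ 0) (m≤m+n _ _)) (m≤n+m _ (𝟙 (E? u w ×-dec ((S? u ×-dec no (λ ne → ne refl)) ×-dec (S? w ×-dec ¬? (u ≟F w))))))
      ... | no v≢u with v ≟F w
      ...   | yes refl = ≤-trans (𝟙-mono {p? = within? S? u v} {q? = within? S? v u} (λ (e , s₁ , s₂) → E-sym e , s₂ , s₁))
                           (≤-trans (m≤m+n _ 0) (m≤n+m _ (𝟙 (E? u w ×-dec ((S? u ×-dec yes v≢u) ×-dec (S? w ×-dec no (λ ne → ne refl)))))))
      ...   | no v≢w = ≤-trans (𝟙-mono {p? = within? S? u w} {q? = E? u w ×-dec ((S? u ×-dec yes v≢u) ×-dec (S? w ×-dec yes v≢w))}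
                           (λ (e , s₁ , s₂) → e , (s₁ , v≢u) , (s₂ , v≢w))) (m≤m+n _ _)
    dense′ : 2 * d * # T? < ## (within? T?)
    dense′ = +-cancelʳ-< (d + d) _ _ (begin-strict
      2 * d * # T? + (d + d)          ≡⟨ arith d (# T?) ⟩
      2 * d * suc (# T?)              ≤⟨ *-monoʳ-≤ (2 * d) smaller ⟩
      2 * d * # S?                    <⟨ dense ⟩
      ## (within? S?)                 ≤⟨ lost ⟩
      ## (within? T?) + (deg + deg)   ≤⟨ +-monoʳ-≤ (## (within? T?)) (+-mono-≤ (<⇒≤ low) (<⇒≤ low)) ⟩
      ## (within? T?) + (d + d)       ∎)
      where
      open ≤-Reasoning
      arith : ∀ d t → 2 * d * t + (d + d) ≡ 2 * d * suc t
      arith = solve-∀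

-- Opaque, lest products with the numeral be unfolded.
opaque
  ratio : ℕ
  ratio = 1040

  1≤ratio : 1 ≤ ratio
  1≤ratio = from-yes (1 ≤? 1040)

  14≤ratio : 14 ≤ ratio
  14≤ratio = from-yes (14 ≤? 1040)

  130≤ratio : 130 ≤ ratio
  130≤ratio = from-yes (130 ≤? 1040)

  1040≤ratio : 1040 ≤ ratio
  1040≤ratio = ≤-refl

-- Growth of the distance levels

module _ (G : Graph) (free : ThetaFree 3 4 G)
         {F : V G → V G → Set} (F? : ∀ u v → Dec (F u v))
         (F⊆E : ∀ {u v} → F u v → E G u v) (F-sym : ∀ {u v} → F u v → F v u)
         {x : V G} (L : Layering F x 4) where

  open Layering L

  Level : ℕ → V G → Set
  Level i v = lev v ≡ i

  level? : ∀ i v → Dec (Level i v)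
  level? i v = lev v ≟ i

  parent? : ∀ v → Dec (∃ λ u → F u v × suc (lev u) ≡ lev v)
  parent? v = FinP.any? λ u → F? u v ×-dec (suc (lev u) ≟ lev v)

  par : V G → V G
  par v with parent? v
  ... | yes (u , _) = u
  -- A default value: every vertex on the levels 1 to 4 has a parent.
  ... | no _        = v

  par-spec : ∀ {v j} → j < 4 → Level (suc j) v → E G (par v) v × Level j (par v)
  par-spec {v} j<4 e with parent? v
  ... | yes (u , f , e′) = F⊆E f , suc-injective (trans e′ e)
  ... | no ¬w = let u , f , e′ = parent j<4 e in contradiction (u , f , trans (cong suc e′) (sym e)) ¬w

  -- Vertices off level k stay fixed, which gives the idempotence that colourings need:
  -- `ascend 2 ∘ ascend 3` gives a vertex of level 3, its parent and its grandparent one colour.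
  ascend : ℕ → V G → V G
  ascend k v with lev v ≟ k
  ... | yes _ = par v
  ... | no _  = v

  ascend-on : ∀ {k v} → Level k v → ascend k v ≡ par v
  ascend-on {k} {v} e with lev v ≟ k
  ... | yes _ = refl
  ... | no ne = contradiction e ne

  ascend-off : ∀ {k v} → lev v ≢ k → ascend k v ≡ v
  ascend-off {k} {v} ne with lev v ≟ k
  ... | yes e = contradiction e ne
  ... | no _  = refl

  level-≢ : ∀ {u v j} → Level j u → lev v ≢ j → v ≢ u
  level-≢ e ne refl = ne e

  -- B stays free for two uses in `level-growth`: from level i + 1 to the levels i + 1 and i + 2,
  -- and from level i to level i + 1.
  Out : ℕ → (V G → Set) → V G → V G → Set
  Out i B a b = F a b × Level i a × i ≤ lev b × B b

  out? : ∀ i {B : V G → Set} (B? : ∀ b → Dec (B b)) a b → Dec (Out i B a b)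
  out? i B? a b = F? a b ×-dec (level? i a ×-dec ((i ≤? lev b) ×-dec B? b))

  -- For i > 0, the condition i ≤ lev b keeps b away from x and from the ancestors of a, as the
  -- level lemmas require.
  out-edges : ∀ i → i < 4 → {B : V G → Set} (B? : ∀ b → Dec (B b)) →
    ## (out? i B?) ≤ ratio * (# (level? i) + # B?)
  out-edges 0 _ {B} B? = begin
    ## (out? 0 B?)                                       ≤⟨ pruneᶜ (out? 0 B?) 1 B? (λ (_ , _ , _ , b) → b) ⟩
    ## (flip (prune? (flip (out? 0 B?)) 1)) + 1 * # B?
      ≡⟨ cong (_+ 1 * # B?) (##-none {R? = flip (prune? (flip (out? 0 B?)) 1)} (λ (_ , lt) → ≤⇒≯ single lt)) ⟩
    1 * # B?                                             ≤⟨ *-mono-≤ {1} {ratio} 1≤ratio (m≤n+m _ (# (level? 0))) ⟩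
    ratio * (# (level? 0) + # B?)                         ∎
    where
    open ≤-Reasoning
    single : ∀ {b} → # (λ a → out? 0 B? a b) ≤ 1
    single = ≤-trans (#-mono (λ (_ , e , _) → sym (root! e))) (≤-reflexive (#-≡ x))
  out-edges 1 i<4 B? = ≤-trans
    (level₁ G free (out? 1 B?) (level? 1) B? (λ (_ , e , _) → e) (λ (_ , _ , _ , b) → b) (λ (f , _) → F⊆E f) x
      (λ (_ , e , _) → let f , e′ = par-spec (s≤s z≤n) e in subst (λ z → E G z _) (root! e′) f)
      (λ (_ , _ , le , _) → level-≢ root (>⇒≢ le)))
    (*-monoˡ-≤ _ 14≤ratio)
  out-edges 2 i<4 {B} B? = ≤-trans
    (level₂ G free (out? 2 B?) (level? 2) B? (λ (_ , e , _) → e) (λ (_ , _ , _ , b) → b) (λ (f , _) → F⊆E f) x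
      (ascend 2)
      (λ h → subst₂ (E G) (root! (level-par² h)) (sym (on h)) (proj₁ (par-spec (s≤s z≤n) (level-par h))))
      (λ h → subst (λ z → E G z _) (sym (on h)) (proj₁ (par-spec (s≤s (s≤s z≤n)) (proj₁ (proj₂ h)))))
      (λ h → ascend-off (λ e → contradiction (trans (sym (level-asc h)) e) λ ()))
      (λ (_ , e , _) → level-≢ root (λ e′ → contradiction (trans (sym e) e′) λ ()))
      (λ h → level-≢ (level-asc h) (>⇒≢ (proj₁ (proj₂ (proj₂ h))))))
    (*-monoˡ-≤ _ 130≤ratio)
    where
    on : ∀ {a b} → Out 2 B a b → ascend 2 a ≡ par a
    on (_ , e , _) = ascend-on e
    level-par : ∀ {a b} → Out 2 B a b → Level 1 (par a)
    level-par (_ , e , _) = proj₂ (par-spec (s≤s (s≤s z≤n)) e)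
    level-par² : ∀ {a b} → Out 2 B a b → Level 0 (par (par a))
    level-par² h = proj₂ (par-spec (s≤s z≤n) (level-par h))
    level-asc : ∀ {a b} → Out 2 B a b → Level 1 (ascend 2 a)
    level-asc h = trans (cong lev (on h)) (level-par h)
  out-edges 3 i<4 {B} B? = ≤-trans
    (level₃ G free (out? 3 B?) (level? 3) B? (λ (_ , e , _) → e) (λ (_ , _ , _ , b) → b) (λ (f , _) → F⊆E f) x
      col₁ (ascend 3)
      (λ h → subst₂ (E G) (root! (proj₂ (par₁ h))) (sym (col₁≡ h)) (proj₁ (par₁ h)))
      (λ h → subst₂ (E G) (sym (col₁≡ h)) (sym (on h)) (proj₁ (par₂ h)))
      (λ h → subst (λ z → E G z _) (sym (on h)) (proj₁ (par₃ h)))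
      (λ h → trans (cong col₁ (col₁≡ h)) (trans (col₁-low (subst (_≤ 1) (sym (proj₂ (par₂ h))) ≤-refl)) (sym (col₁≡ h))))
      (λ h → cong (ascend 2) (idem₃ h))
      idem₃
      (λ h → level-≢ (trans (cong lev (col₁≡ h)) (proj₂ (par₂ h))) (λ e → contradiction (trans (sym (proj₁ (proj₂ h))) e) λ ()))
      (λ (_ , _ , le , _) → level-≢ root (>⇒≢ (≤-trans (s≤s z≤n) le)))
      (λ h → level-≢ (trans (cong lev (on h)) (proj₂ (par₃ h))) (>⇒≢ (proj₁ (proj₂ (proj₂ h))))))
    (*-monoˡ-≤ _ 1040≤ratio)
    where
    col₁ : V G → V G
    col₁ = ascend 2 ∘ ascend 3
    on : ∀ {a b} → Out 3 B a b → ascend 3 a ≡ par a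
    on (_ , e , _) = ascend-on e
    par₃ : ∀ {a b} → Out 3 B a b → E G (par a) a × Level 2 (par a)
    par₃ (_ , e , _) = par-spec (s≤s (s≤s (s≤s z≤n))) e
    par₂ : ∀ {a b} → Out 3 B a b → E G (par (par a)) (par a) × Level 1 (par (par a))
    par₂ h = par-spec (s≤s (s≤s z≤n)) (proj₂ (par₃ h))
    par₁ : ∀ {a b} → Out 3 B a b → E G (par (par (par a))) (par (par a)) × Level 0 (par (par (par a)))
    par₁ h = par-spec (s≤s z≤n) (proj₂ (par₂ h))
    col₁≡ : ∀ {a b} → Out 3 B a b → col₁ a ≡ par (par a)
    col₁≡ h = trans (cong (ascend 2) (on h)) (ascend-on (proj₂ (par₃ h)))
    col₁-low : ∀ {v} → lev v ≤ 1 → col₁ v ≡ v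
    col₁-low le = trans (cong (ascend 2) (ascend-off (<⇒≢ (≤-trans (s≤s le) (n≤1+n 2))))) (ascend-off (<⇒≢ (s≤s le)))
    idem₃ : ∀ {a b} → Out 3 B a b → ascend 3 (ascend 3 a) ≡ ascend 3 a
    idem₃ h = ascend-off (λ e → contradiction (trans (sym (trans (cong lev (on h)) (proj₂ (par₃ h)))) e) λ ())
  out-edges (suc (suc (suc (suc _)))) (s≤s (s≤s (s≤s (s≤s ()))))

  module _ (D : ℕ) (min-degree : ∀ {v} → lev v < 4 → ratio * (D + 4) ≤ # (F? v)) where

    level-growth₀ : D ≤ # (level? 1)
    level-growth₀ = ≤-trans (≤-trans (m≤m+n D 4) (m≤n*m (D + 4) ratio {{>-nonZero 1≤ratio}})) (≤-trans (min-degree (≤-trans (s≤s (≤-reflexive root)) (s≤s z≤n))) (#-mono first))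
      where
      first : ∀ {b} → F x b → Level 1 b
      first {b} f with lev b in eq | step f (≤-trans (s≤s (≤-reflexive root)) (s≤s z≤n))
      ... | 0 | _ = contradiction (sym (root! eq)) (E-irrefl G (F⊆E f))
      ... | 1 | _ = refl
      ... | suc (suc _) | le = contradiction (subst (λ z → _ ≤ suc z) root le) λ { (s≤s ()) }

    -- Let w, v, z be the sizes of the levels i, i + 1, i + 2. The degrees on level i + 1 add up to
    -- at least ratio (D + 4) v and at most ratio ((v + v + z) + (w + v)). As w ≤ v, the term 4 v
    -- cancels.
    level-growth : ∀ i → suc i < 4 → # (level? i) ≤ # (level? (suc i)) → D * # (level? (suc i)) ≤ # (level? (suc (suc i)))
    level-growth i i<4 mono = *-cancelˡ-≤ ratio {{>-nonZero 1≤ratio}} (+-cancelʳ-≤ (ratio * (4 * v)) _ _ (begin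
      ratio * (D * v) + ratio * (4 * v)             ≡⟨ arith₁ ratio D v ⟩
      ratio * (D + 4) * v                          ≡⟨ sum-* (ratio * (D + 4)) _ ⟩
      sum (λ a → ratio * (D + 4) * 𝟙 (level? (suc i) a))  ≤⟨ sum-mono row ⟩
      sum (λ a → # (up? a) + # (down? a))         ≡⟨ sum-+ _ _ ⟩
      ## up? + ## down?                           ≤⟨ +-mono-≤ (out-edges (suc i) i<4 near?) down-bound ⟩
      ratio * (v + # near?) + ratio * (w + v)       ≤⟨ +-mono-≤ (*-monoʳ-≤ ratio (+-monoʳ-≤ v #near)) (*-monoʳ-≤ ratio (+-monoˡ-≤ v mono)) ⟩
      ratio * (v + (v + z)) + ratio * (v + v)       ≡⟨ arith₂ ratio v z ⟩
      ratio * z + ratio * (4 * v)                   ∎))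
      where
      open ≤-Reasoning
      w v z : ℕ
      w = # (level? i)
      v = # (level? (suc i))
      z = # (level? (suc (suc i)))
      arith₁ : ∀ c D v → c * (D * v) + c * (4 * v) ≡ c * (D + 4) * v
      arith₁ = solve-∀
      arith₂ : ∀ c v z → c * (v + (v + z)) + c * (v + v) ≡ c * z + c * (4 * v)
      arith₂ = solve-∀
      near? : ∀ b → Dec (Level (suc i) b ⊎ Level (suc (suc i)) b)
      near? b = level? (suc i) b ⊎-dec level? (suc (suc i)) b
      up? = out? (suc i) near?
      down? : ∀ a b → Dec (Out i (Level (suc i)) b a)
      down? = flip (out? i (level? (suc i)))
      down-bound : ## down? ≤ ratio * (w + v)
      down-bound = ≤-trans (≤-reflexive (##-flip down?)) (out-edges i (<⇒≤ i<4) (level? (suc i)))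
      #near : # near? ≤ v + z
      #near = #-∪ (level? (suc i)) (level? (suc (suc i))) id
      row : ∀ a → ratio * (D + 4) * 𝟙 (level? (suc i) a) ≤ # (up? a) + # (down? a)
      row a = *-𝟙≤ (level? (suc i) a) λ e → ≤-trans (min-degree (lev-a<4 e)) (#-∪ (up? a) (down? a) (classify e))
        where
        lev-a<4 : Level (suc i) a → lev a < 4
        lev-a<4 e = ≤-trans (s≤s (≤-reflexive e)) i<4
        classify : Level (suc i) a → ∀ {b} → F a b → Out (suc i) (λ b → Level (suc i) b ⊎ Level (suc (suc i)) b) a b ⊎ Out i (Level (suc i)) b a
        classify e {b} f with lev b ≤? i
        ... | yes le = inj₂ (F-sym f ,
                ≤-antisym le (s≤s⁻¹ (subst (_≤ suc (lev b)) e (step (F-sym f) (≤-<-trans le (<⇒≤ i<4))))) ,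
                ≤-trans (n≤1+n i) (≤-reflexive (sym e)) , e)
        ... | no gt with m≤n⇒m<n∨m≡n (≰⇒> gt)
        ...   | inj₂ eq = inj₁ (f , e , ≤-reflexive eq , inj₁ (sym eq))
        ...   | inj₁ lt = inj₁ (f , e , ≰⇒> gt , inj₂ (≤-antisym (subst (λ l → lev b ≤ suc l) e (step f (lev-a<4 e))) lt))

    many-vertices : .{{_ : NonZero D}} → D ^ 4 ≤ Graph.n G
    many-vertices = begin
      D * (D * (D * (D * 1)))  ≤⟨ *-monoʳ-≤ D (*-monoʳ-≤ D (*-monoʳ-≤ D (≤-trans (≤-reflexive (*-identityʳ D)) level-growth₀))) ⟩
      D * (D * (D * # (level? 1)))   ≤⟨ *-monoʳ-≤ D (*-monoʳ-≤ D e₁) ⟩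
      D * (D * # (level? 2))    ≤⟨ *-monoʳ-≤ D e₂ ⟩
      D * # (level? 3)          ≤⟨ level-growth 2 ≤-refl (≤-trans (m≤n*m _ D) e₂) ⟩
      # (level? 4)              ≤⟨ #≤n (level? 4) ⟩
      Graph.n G                 ∎
      where
      open ≤-Reasoning
      one : # (level? 0) ≤ # (level? 1)
      one = ≤-trans (#-mono (λ e → sym (root! e))) (≤-trans (≤-reflexive (#-≡ x)) (≤-trans (>-nonZero⁻¹ D) level-growth₀))
      e₁ : D * # (level? 1) ≤ # (level? 2)
      e₁ = level-growth 0 (s≤s (s≤s z≤n)) one
      e₂ : D * # (level? 2) ≤ # (level? 3)
      e₂ = level-growth 1 (s≤s (s≤s (s≤s z≤n))) (≤-trans (m≤n*m _ D) e₁)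

-- The lower bound

opaque
  unfolding sum
  length-filter : ∀ {m} {A : Set} {P : A → Set} (P? : ∀ a → Dec (P a)) (f : Fin m → A) →
    length (filter P? (tabulate f)) ≡ # (P? ∘ f)
  length-filter {zero}  P? f = refl
  length-filter {suc m} P? f with P? (f zero)
  ... | yes _ = cong suc (length-filter P? (f ∘ suc))
  ... | no _  = length-filter P? (f ∘ suc)

partSize≡ : ∀ {m r} (p : Fin m → Fin r) i → partSize p i ≡ # (λ v → p v ≟F i)
partSize≡ p i = length-filter (λ v → p v ≟F i) id

vertices≤ : ∀ {m r k} (p : Fin m → Fin r) → (∀ i → partSize p i ≤ k) → m ≤ r * k
vertices≤ {m} {r} {k} p small = begin
  m                                            ≡⟨ trans (sum-const m 1) (*-identityʳ m) ⟨
  # {m} (λ _ → yes tt)                         ≡⟨ fibre-# (λ _ → yes tt) p ⟨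
  sum (λ i → # (λ v → yes tt ×-dec (p v ≟F i)))  ≤⟨ sum-mono (λ i → ≤-trans (#-mono proj₂) (≤-trans (≤-reflexive (sym (partSize≡ p i))) (small i))) ⟩
  sum {r} (λ _ → k)                            ≡⟨ sum-const r k ⟩
  r * k                                        ∎
  where open ≤-Reasoning

fibre-𝟙 : ∀ {m} {P : Set} (P? : Dec P) (c : Fin m) → sum (λ j → 𝟙 (P? ×-dec (c ≟F j))) ≡ 𝟙 P?
fibre-𝟙 P? c = trans (sum-cong (λ j → trans (𝟙-× P? (c ≟F j)) (*-comm (𝟙 P?) _))) (sum-δ c (λ _ → 𝟙 P?))

-- An ordered edge (u , v) serves only the pair (p u , p v); the summand r pays for the diagonal.
pairs≤ : ∀ {m r} {E : Fin m → Fin m → Set} (E? : ∀ u v → Dec (E u v)) (p : Fin m → Fin r) →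
  (∀ i j → i ≢ j → ∃₂ λ u v → p u ≡ i × p v ≡ j × E u v) → r * r ≤ ## E? + r
pairs≤ {m} {r} E? p cross = begin
  r * r                                          ≡⟨ trans (sum-cong {r} (λ _ → trans (sum-const r 1) (*-identityʳ r))) (sum-const r r) ⟨
  sum {r} (λ _ → sum {r} (λ _ → 1))              ≤⟨ sum-sum-mono pt ⟩
  sum (λ i → sum (λ j → sum (λ u → sum (λ v → K u v i j)) + 𝟙 (i ≟F j)))
    ≡⟨ trans (sum-cong (λ i → trans (sum-+ _ _) (cong (sum (λ j → sum (λ u → sum (λ v → K u v i j))) +_) (#-≡ i)))) (sum-+ {r} _ _) ⟩
  sum (λ i → sum (λ j → sum (λ u → sum (λ v → K u v i j)))) + sum {r} (λ _ → 1)
    ≡⟨ cong₂ _+_ reorder (trans (sum-const r 1) (*-identityʳ r)) ⟩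
  ## E? + r                                      ∎
  where
  open ≤-Reasoning
  K : Fin m → Fin m → Fin r → Fin r → ℕ
  K u v i j = 𝟙 ((E? u v ×-dec (p u ≟F i)) ×-dec (p v ≟F j))
  pt : ∀ i j → 1 ≤ sum (λ u → sum (λ v → K u v i j)) + 𝟙 (i ≟F j)
  pt i j with i ≟F j
  ... | yes _ = m≤n+m 1 _
  ... | no ne = let u , v , eᵤ , eᵥ , e = cross i j ne in
    ≤-trans (≤-reflexive (sym (𝟙-true {p? = (E? u v ×-dec (p u ≟F i)) ×-dec (p v ≟F j)} ((e , eᵤ) , eᵥ))))
      (≤-trans (term≤sum (λ v → K u v i j) v) (≤-trans (term≤sum (λ u → sum (λ v → K u v i j)) u) (m≤m+n _ _)))
  reorder : sum (λ i → sum (λ j → sum (λ u → sum (λ v → K u v i j)))) ≡ ## E?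
  reorder =
    trans (sum-cong (λ i → sum-swap (λ j u → sum (λ v → K u v i j))))
    (trans (sum-swap (λ i u → sum (λ j → sum (λ v → K u v i j))))
    (sum-cong λ u →
    trans (sum-cong (λ i → sum-swap (λ j v → K u v i j)))
    (trans (sum-swap (λ i v → sum (λ j → K u v i j)))
    (sum-cong λ v →
    trans (sum-cong (λ i → fibre-𝟙 (E? u v ×-dec (p u ≟F i)) (p v)))
          (fibre-𝟙 (E? u v) (p u))))))

module _ (G : Graph) (free : ThetaFree 3 4 G) where

  dense⇒many-vertices : ∀ D → .{{_ : NonZero D}} →
    2 * (ratio * (D + 4)) * Graph.n G < ## (E? G) → D ^ 4 ≤ Graph.n G
  dense⇒many-vertices D dense
    with min-degree-subset (E? G) (E-sym G) (ratio * (D + 4)) (Graph.n G) {S = λ _ → ⊤} (λ _ → yes tt) (#≤n {P = λ _ → ⊤} (λ _ → yes tt))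
           (<-≤-trans (≤-<-trans (*-monoʳ-≤ (2 * (ratio * (D + 4))) (#≤n {Graph.n G} (λ _ → yes tt))) dense) (##-mono (λ e → e , tt , tt)))
  ... | T , T? , (x , tx) , deg =
    many-vertices G free F? proj₁ (λ (e , s , t) → E-sym G e , t , s) L D (λ {v} lt → deg (inside v (L.lev v) refl lt))
    where
    F? = within? (E? G) (E-sym G) T?
    L = layering F? x 4
    module L = Layering L
    -- Large degree is known only inside T. A vertex of level below 4 is x or has a parent along an
    -- edge within T, so it lies in T.
    inside : ∀ v l → L.lev v ≡ l → L.lev v < 4 → T v
    inside v zero    e _  = subst T (sym (L.root! e)) tx
    inside v (suc j) e lt = let _ , (_ , _ , t) , _ = L.parent (≤-trans (n≤1+n _) (subst (_< 4) e lt)) e in t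

  parts-bound : ∀ {r k} → IsRKGraph r k G → ∀ D → .{{_ : NonZero D}} →
    suc (2 * (ratio * (D + 4)) * k) < r → D ^ 4 ≤ r * k
  parts-bound {r} {k} (p , small , cross) D lt =
    ≤-trans (dense⇒many-vertices D dense) n≤
    where
    n≤ = vertices≤ p small
    q : ℕ
    q = 2 * (ratio * (D + 4))
    dense : q * Graph.n G < ## (E? G)
    dense = ≤-<-trans (*-monoʳ-≤ q n≤) (+-cancelʳ-< r _ _ (begin-strict
      q * (r * k) + r     ≡⟨ arith q r k ⟩
      r * suc (q * k)     <⟨ *-monoʳ-< r {{>-nonZero (≤-<-trans z≤n lt)}} lt ⟩
      r * r               ≤⟨ pairs≤ (E? G) p cross ⟩
      ## (E? G) + r       ∎))
      where
      open ≤-Reasoning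
      arith : ∀ q r k → q * (r * k) + r ≡ r * suc (q * k)
      arith = solve-∀

^-distribʳ-* : ∀ o m n → (m * n) ^ o ≡ m ^ o * n ^ o
^-distribʳ-* zero    m n = refl
^-distribʳ-* (suc o) m n = trans (cong (m * n *_) (^-distribʳ-* o m n)) ([m*n]*[o*p]≡[m*o]*[n*p] m n (m ^ o) (n ^ o))

-- Take D = r / (c k). If D = 0, then r < c k. Otherwise r < 2 c k D, so r⁴ < (2 c k)⁴ D⁴ ≤ (2 c k)⁴
-- r k, and r cancels.
fourth-power-bound : ∀ c r k .{{_ : NonZero c}} .{{_ : NonZero r}} .{{_ : NonZero k}} →
  (∀ D → .{{NonZero D}} → c * D * k ≤ r → D ^ 4 ≤ r * k) → r ^ 3 < (2 * c) ^ 4 * k ^ 5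
fourth-power-bound c r k hyp = go (r / q) refl
  where
  open ≤-Reasoning
  q : ℕ
  q = c * k
  instance
    q≢0 : NonZero q
    q≢0 = m*n≢0 c k
  r<q+ : r < q * suc (r / q)
  r<q+ = begin-strict
    r                    ≡⟨ m≡m%n+[m/n]*n r q ⟩
    r % q + r / q * q    <⟨ +-monoˡ-< (r / q * q) (m%n<n r q) ⟩
    q + r / q * q        ≡⟨ *-comm (suc (r / q)) q ⟩
    q * suc (r / q)      ∎
  cube : ∀ {a b} → a < b → a ^ 3 < b ^ 3
  cube lt = ^-monoˡ-< 3 lt
  go : ∀ D → D ≡ r / q → r ^ 3 < (2 * c) ^ 4 * k ^ 5
  go zero e = begin-strict
    r ^ 3                      <⟨ cube (subst (r <_) (trans (cong (λ d → q * suc d) (sym e)) (*-identityʳ q)) r<q+) ⟩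
    (c * k) ^ 3                ≡⟨ ^-distribʳ-* 3 c k ⟩
    c ^ 3 * k ^ 3              ≤⟨ *-mono-≤ (≤-trans (^-monoˡ-≤ 3 (m≤n*m c 2)) (^-monoʳ-≤ (2 * c) {{m*n≢0 2 c}} (n≤1+n 3))) (^-monoʳ-≤ k (m≤m+n 3 2)) ⟩
    (2 * c) ^ 4 * k ^ 5        ∎
  go (suc d) e = *-cancelˡ-< r _ _ (begin-strict
    r ^ 4                                <⟨ ^-monoˡ-< 4 (<-≤-trans r<q+ (≤-trans (≤-reflexive (cong (λ d → q * suc d) (sym e))) (≤-trans (*-monoʳ-≤ q (≤-trans (≤-reflexive (+-comm 1 D)) (+-monoʳ-≤ D (s≤s z≤n)))) (≤-reflexive (arith₁ c k D))))) ⟩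
    (2 * c * k * D) ^ 4                  ≡⟨ trans (^-distribʳ-* 4 (2 * c * k) D) (cong (_* D ^ 4) (^-distribʳ-* 4 (2 * c) k)) ⟩
    (2 * c) ^ 4 * k ^ 4 * D ^ 4          ≤⟨ *-monoʳ-≤ ((2 * c) ^ 4 * k ^ 4) (hyp D (≤-trans (≤-reflexive (trans (arith₂ c D k) (cong (_* q) e))) (m/n*n≤m r q))) ⟩
    (2 * c) ^ 4 * k ^ 4 * (r * k)        ≡⟨ arith₃ ((2 * c) ^ 4) (k ^ 4) r k ⟩
    r * ((2 * c) ^ 4 * k ^ 5)            ∎)
    where
    D : ℕ
    D = suc d
    arith₁ : ∀ c k D → c * k * (D + D) ≡ 2 * c * k * D
    arith₁ = solve-∀
    arith₂ : ∀ c D k → c * D * k ≡ D * (c * k)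
    arith₂ = solve-∀
    arith₃ : ∀ x y r k → x * y * (r * k) ≡ r * (x * (k * y))
    arith₃ = solve-∀

opaque
  unfolding ratio

  -- 2 ratio (D + 4) ≤ 10 ratio D; the summand 2 pays for `suc` and the strict inequality in
  -- `parts-bound`.
  lower-constant : ℕ
  lower-constant = 10 * ratio + 2

  lower-constant≡ : lower-constant ≡ 10 * ratio + 2
  lower-constant≡ = refl

lower-constant≢0 : NonZero lower-constant
lower-constant≢0 = subst NonZero (trans (+-comm 2 (10 * ratio)) (sym lower-constant≡)) _

lower-bound : ∀ {r k} (G : Graph) → .{{NonZero r}} → .{{NonZero k}} →
  ThetaFree 3 4 G → IsRKGraph r k G → r ^ 3 < (2 * lower-constant) ^ 4 * k ^ 5
lower-bound {r} {k} G free rk =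
  fourth-power-bound lower-constant r k {{lower-constant≢0}}
    λ D le → parts-bound G free rk D (≤-trans (big ratio D k) (subst (λ c → c * D * k ≤ r) lower-constant≡ le))
  where
  big : ∀ q D k .{{_ : NonZero D}} .{{_ : NonZero k}} → suc (suc (2 * (q * (D + 4)) * k)) ≤ (10 * q + 2) * D * k
  big q D k = begin
    2 + 2 * (q * (D + 4)) * k                   ≤⟨ +-mono-≤ (*-monoʳ-≤ 2 (*-mono-≤ {1} {D} {1} {k} (>-nonZero⁻¹ D) (>-nonZero⁻¹ k)))
                                                     (*-monoˡ-≤ k (*-monoʳ-≤ 2 (*-monoʳ-≤ q (+-monoʳ-≤ D (m≤n*m 4 D))))) ⟩
    2 * (D * k) + 2 * (q * (D + D * 4)) * k     ≡⟨ arith q D k ⟩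
    (10 * q + 2) * D * k                        ∎
    where
    open ≤-Reasoning
    arith : ∀ q D k → 2 * (D * k) + 2 * (q * (D + D * 4)) * k ≡ (10 * q + 2) * D * k
    arith = solve-∀

-- Primes

pascal : ∀ n k → suc n C suc k ≡ n C k + n C suc k
pascal n k = sym (nCk+nC[k+1]≡[n+1]C[k+1] n k)

absorption : ∀ n k → suc k * (suc n C suc k) ≡ suc n * (n C k)
absorption zero zero = refl
absorption zero (suc k) = trans (cong (suc (suc k) *_) (k>n⇒nCk≡0 {1} {suc (suc k)} (s≤s (s≤s z≤n)))) (*-zeroʳ (suc (suc k)))
absorption (suc n) zero = trans (cong (1 *_) (nC1≡n (suc (suc n)))) (*-comm 1 (suc (suc n)))
absorption (suc n) (suc k) = begin
  suc (suc k) * (suc (suc n) C suc (suc k))                  ≡⟨ cong (suc (suc k) *_) (pascal (suc n) (suc k)) ⟩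
  suc (suc k) * (x + suc n C suc (suc k))                    ≡⟨ expand (suc k) x (suc n C suc (suc k)) ⟩
  suc k * x + suc (suc k) * (suc n C suc (suc k)) + x        ≡⟨ cong₂ (λ a b → a + b + x) (absorption n k) (absorption n (suc k)) ⟩
  suc n * (n C k) + suc n * (n C suc k) + x                  ≡⟨ cong (_+ x) (trans (sym (*-distribˡ-+ (suc n) (n C k) (n C suc k))) (cong (suc n *_) (sym (pascal n k)))) ⟩
  suc n * x + x                                              ≡⟨ +-comm (suc n * x) x ⟩
  suc (suc n) * x                                            ∎
  where
  open ≡-Reasoning
  x : ℕ
  x = suc n C suc k
  expand : ∀ k x y → suc k * (x + y) ≡ k * x + suc k * y + x
  expand = solve-∀

nCk>0 : ∀ {n k} → k ≤ n → 0 < n C k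
nCk>0 {n} {zero}  _ = s≤s z≤n
nCk>0 {suc n} {suc k} (s≤s k≤n) = subst (0 <_) (sym (pascal n k)) (≤-trans (nCk>0 k≤n) (m≤m+n _ _))

nCk≤2^n : ∀ n k → n C k ≤ 2 ^ n
nCk≤2^n n       zero    = m^n>0 2 n
nCk≤2^n zero    (suc k) = subst (_≤ 1) (sym (k>n⇒nCk≡0 {0} {suc k} (s≤s z≤n))) z≤n
nCk≤2^n (suc n) (suc k) = subst (_≤ 2 ^ suc n) (sym (pascal n k))
  (≤-trans (+-mono-≤ (nCk≤2^n n k) (nCk≤2^n n (suc k))) (≤-reflexive (cong (2 ^ n +_) (sym (+-identityʳ (2 ^ n))))))

nCk≤[1+n]Ck : ∀ n k → n C k ≤ suc n C k
nCk≤[1+n]Ck n zero    = ≤-refl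
nCk≤[1+n]Ck n (suc k) = subst (n C suc k ≤_) (sym (pascal n k)) (m≤n+m _ _)

2^n≤[n+n]Cn : ∀ n → 2 ^ n ≤ (n + n) C n
2^n≤[n+n]Cn zero    = ≤-refl
2^n≤[n+n]Cn (suc n) = begin
  2 * 2 ^ n                                        ≤⟨ *-monoʳ-≤ 2 (2^n≤[n+n]Cn n) ⟩
  2 * x                                            ≡⟨ cong (x +_) (+-identityʳ x) ⟩
  x + x                                            ≤⟨ +-mono-≤ (nCk≤[1+n]Ck (n + n) n) (≤-trans (m≤m+n x _) (≤-reflexive (sym (pascal (n + n) n)))) ⟩
  suc (n + n) C n + suc (n + n) C suc n            ≡⟨ pascal (suc (n + n)) n ⟨
  suc (suc (n + n)) C suc n                        ≡⟨ cong (λ z → suc z C suc n) (+-suc n n) ⟨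
  (suc n + suc n) C suc n                          ∎
  where
  open ≤-Reasoning
  x : ℕ
  x = (n + n) C n

CommonMultiple : ℕ → ℕ → Set
CommonMultiple n L = ∀ i → 1 ≤ i → i ≤ n → i ∣ L

-- Leibniz's harmonic triangle: 1/((k+2) C(n+1,k+2)) = 1/((k+1) C(n,k+1)) − 1/((k+1) C(n+1,k+1)).
leibniz : ∀ k n {L} → CommonMultiple n L → suc k ≤ n → suc k * (n C suc k) ∣ L
leibniz zero n {L} cm k<n = subst (_∣ L) (sym (trans (+-identityʳ _) (nC1≡n n))) (cm n k<n ≤-refl)
leibniz (suc k) (suc n) {L} cm (s≤s k<n)
  with leibniz k n (λ i 1≤i i≤n → cm i 1≤i (m≤n⇒m≤1+n i≤n)) k<n | leibniz k (suc n) cm (m≤n⇒m≤1+n k<n)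
-- From L = α A = β B and B = A + D follows (α - β) A = β D; with T D = A B this gives (α - β) T D =
-- β D B = L D.
... | divides α αA | divides β βB = divides (α ∸ β) (*-cancelʳ-≡ L ((α ∸ β) * T) D (begin
  L * D                 ≡⟨ cong (_* D) βB ⟩
  β * B * D             ≡⟨ swap β B D ⟩
  β * D * B             ≡⟨ cong (_* B) difference ⟨
  (α ∸ β) * A * B       ≡⟨ trans (*-assoc (α ∸ β) A B) (cong ((α ∸ β) *_) (sym TD≡AB)) ⟩
  (α ∸ β) * (T * D)     ≡⟨ *-assoc (α ∸ β) T D ⟨
  (α ∸ β) * T * D       ∎))
  where
  open ≡-Reasoning
  A B T D : ℕ
  A = suc k * (n C suc k)
  B = suc k * (suc n C suc k)
  T = suc (suc k) * (suc n C suc (suc k))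
  D = suc k * (n C k)
  instance
    D≢0 : NonZero D
    D≢0 = m*n≢0 (suc k) (n C k) {{_}} {{>-nonZero (nCk>0 (<⇒≤ k<n))}}
  swap : ∀ a b c → a * b * c ≡ a * c * b
  swap = solve-∀
  B≡A+D : B ≡ A + D
  B≡A+D = trans (cong (suc k *_) (trans (pascal n k) (+-comm (n C k) (n C suc k)))) (*-distribˡ-+ (suc k) (n C suc k) (n C k))
  difference : (α ∸ β) * A ≡ β * D
  difference = begin
    (α ∸ β) * A               ≡⟨ *-distribʳ-∸ A α β ⟩
    α * A ∸ β * A             ≡⟨ cong (_∸ β * A) (trans (sym αA) βB) ⟩
    β * B ∸ β * A             ≡⟨ cong (λ z → β * z ∸ β * A) B≡A+D ⟩
    β * (A + D) ∸ β * A       ≡⟨ cong (_∸ β * A) (*-distribˡ-+ β A D) ⟩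
    β * A + β * D ∸ β * A     ≡⟨ m+n∸m≡n (β * A) (β * D) ⟩
    β * D                     ∎
  TD≡AB : T * D ≡ A * B
  TD≡AB = begin
    T * D                                              ≡⟨ cong (_* D) (absorption n (suc k)) ⟩
    suc n * (n C suc k) * (suc k * (n C k))            ≡⟨ rearrange (suc n) (n C suc k) (suc k) (n C k) ⟩
    suc k * (n C suc k) * (suc n * (n C k))            ≡⟨ cong (A *_) (absorption n k) ⟨
    A * B                                              ∎
    where
    rearrange : ∀ a b c d → a * b * (c * d) ≡ c * b * (a * d)
    rearrange = solve-∀

-- The denominator n C(2n, n) of Leibniz's triangle divides L, and C(2n, n) ≥ 2ⁿ.
2^n≤common-multiple : ∀ n .{{_ : NonZero n}} {L} .{{_ : NonZero L}} → CommonMultiple (n + n) L → 2 ^ n ≤ L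
2^n≤common-multiple (suc n) {L} cm = begin
  2 ^ suc n                             ≤⟨ 2^n≤[n+n]Cn (suc n) ⟩
  (suc n + suc n) C suc n               ≤⟨ m≤n*m _ (suc n) ⟩
  suc n * ((suc n + suc n) C suc n)     ≤⟨ ∣⇒≤ (leibniz n (suc n + suc n) cm (m≤m+n (suc n) (suc n))) ⟩
  L                                     ∎
  where open ≤-Reasoning

prime-∤⇒coprime : ∀ {q n} → Prime q → ¬ q ∣ n → Coprime q n
prime-∤⇒coprime {q} {n} pr q∤n {d} (d∣q , d∣n) with prime⇒irreducible pr d∣q
... | inj₁ d≡1 = d≡1
... | inj₂ d≡q = contradiction (subst (_∣ n) d≡q d∣n) q∤n

coprime-product-∣ : ∀ {a b c} → Coprime a b → a ∣ c → b ∣ c → a * b ∣ c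
coprime-product-∣ {a} {b} co a∣c (divides o refl) = *-monoˡ-∣ b (coprime-divisor co (subst (a ∣_) (*-comm o b) a∣c))

prime∣n!⇒≤ : ∀ {q} n → Prime q → q ∣ n ! → q ≤ n
prime∣n!⇒≤ zero pr d = contradiction (subst Prime (∣1⇒≡1 d) pr) ¬prime[1]
prime∣n!⇒≤ (suc n) pr d with euclidsLemma (suc n) (n !) pr d
... | inj₁ e = ∣⇒≤ e
... | inj₂ e = m≤n⇒m≤1+n (prime∣n!⇒≤ n pr e)

-- q divides (2n)! = C(2n, n) n! n!, but it exceeds n and so does not divide n!.
prime∣central : ∀ {q} n → Prime q → n < q → q ≤ n + n → q ∣ (n + n) C n
prime∣central {q} n pr n<q q≤2n with euclidsLemma ((n + n) C n) (n ! * (n + n ∸ n) !) pr divides-factorial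
  where
  divides-factorial : q ∣ ((n + n) C n) * (n ! * (n + n ∸ n) !)
  divides-factorial = subst (q ∣_)
    (sym (trans (cong (_* (n ! * (n + n ∸ n) !)) (nCk≡n!/k![n-k]! (m≤m+n n n)))
      (m/n*n≡m {{n !* (n + n ∸ n) !≢0}} (k![n∸k]!∣n! (m≤m+n n n)))))
    (∣-trans (self∣ q {{prime⇒nonZero pr}}) (m≤n⇒m!∣n! q≤2n))
    where
    self∣ : ∀ q .{{_ : NonZero q}} → q ∣ q !
    self∣ (suc q) = m∣m*n (q !)
... | inj₁ d = d
... | inj₂ d with euclidsLemma (n !) ((n + n ∸ n) !) pr d
...   | inj₁ e = contradiction (prime∣n!⇒≤ n pr e) (<⇒≱ n<q)
...   | inj₂ e = contradiction (subst (q ≤_) (m+n∸m≡n n n) (prime∣n!⇒≤ (n + n ∸ n) pr e)) (<⇒≱ n<q)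

if-prime : ℕ → ℕ
if-prime i with prime? i
... | yes _ = i
... | no _  = 1

-- The product of the primes in the interval (a , a + l].
primorial : ℕ → ℕ → ℕ
primorial a zero    = 1
primorial a (suc l) = if-prime (a + suc l) * primorial a l

primorial>0 : ∀ a l → 0 < primorial a l
primorial>0 a zero = s≤s z≤n
primorial>0 a (suc l) with prime? (a + suc l)
... | yes pr = *-mono-≤ (>-nonZero⁻¹ _ {{prime⇒nonZero pr}}) (primorial>0 a l)
... | no _   = ≤-trans (primorial>0 a l) (m≤m+n _ 0)

prime∣primorial⇒≤ : ∀ {q} a l → Prime q → q ∣ primorial a l → q ≤ a + l
prime∣primorial⇒≤ a zero pr d = contradiction (subst Prime (∣1⇒≡1 d) pr) ¬prime[1]
prime∣primorial⇒≤ {q} a (suc l) pr d with prime? (a + suc l)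
... | no _ = ≤-trans (prime∣primorial⇒≤ a l pr (subst (q ∣_) (+-identityʳ _) d)) (+-monoʳ-≤ a (n≤1+n l))
... | yes pr′ with euclidsLemma (a + suc l) (primorial a l) pr d
...   | inj₁ e = ∣⇒≤ {{prime⇒nonZero pr′}} e
...   | inj₂ e = ≤-trans (prime∣primorial⇒≤ a l pr e) (+-monoʳ-≤ a (n≤1+n l))

-- A new prime a + l + 1 exceeds all prime factors of the earlier product, so the two are coprime.
primorial∣ : ∀ a l {c} → (∀ {q} → Prime q → a < q → q ≤ a + l → q ∣ c) → primorial a l ∣ c
primorial∣ a zero    h = 1∣ _
primorial∣ a (suc l) {c} h with prime? (a + suc l)
... | no _ = subst (_∣ c) (sym (+-identityʳ _)) (primorial∣ a l λ pr a<q q≤ → h pr a<q (≤-trans q≤ (+-monoʳ-≤ a (n≤1+n l))))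
... | yes pr = coprime-product-∣
  (prime-∤⇒coprime pr λ d → <⇒≱ (≤-reflexive (sym (+-suc a l))) (prime∣primorial⇒≤ a l pr d))
  (h pr (m<m+n a (s≤s z≤n)) ≤-refl)
  (primorial∣ a l λ pr a<q q≤ → h pr a<q (≤-trans q≤ (+-monoʳ-≤ a (n≤1+n l))))

∣primorial : ∀ {q} l → Prime q → q ≤ l → q ∣ primorial 0 l
∣primorial zero pr z≤n = contradiction pr ¬prime[0]
∣primorial {q} (suc l) pr q≤ with m≤n⇒m<n∨m≡n q≤
... | inj₁ (s≤s q≤l) = ∣-trans (∣primorial l pr q≤l) (n∣m*n (if-prime (suc l)))
... | inj₂ refl with prime? (suc l)
...   | yes _  = m∣m*n _
...   | no ¬pr = contradiction pr ¬pr

primorial-+ : ∀ l l′ → primorial 0 (l + l′) ≡ primorial l l′ * primorial 0 l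
primorial-+ l zero    = trans (cong (primorial 0) (+-identityʳ l)) (sym (+-identityʳ _))
primorial-+ l (suc l′) rewrite +-suc l l′ =
  trans (cong (if-prime (suc (l + l′)) *_) (primorial-+ l l′)) (sym (*-assoc (if-prime (suc (l + l′))) (primorial l l′) (primorial 0 l)))

-- Erdős's argument: the primes in (n , 2n] multiply to a divisor of C(2n, n) ≤ 4ⁿ. Powers of two
-- make repeated halving exact.
primorial-bound : ∀ j → primorial 0 (2 ^ j) ≤ 4 ^ (2 ^ j)
primorial-bound zero    = s≤s z≤n
primorial-bound (suc j) = begin
  primorial 0 (n + (n + 0))         ≡⟨ cong (λ z → primorial 0 (n + z)) (+-identityʳ n) ⟩
  primorial 0 (n + n)               ≡⟨ primorial-+ n n ⟩
  primorial n n * primorial 0 n     ≤⟨ *-mono-≤ (∣⇒≤ {{>-nonZero (nCk>0 (m≤m+n n n))}} (primorial∣ n n (prime∣central n))) (primorial-bound j) ⟩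
  ((n + n) C n) * 4 ^ n             ≤⟨ *-monoˡ-≤ (4 ^ n) (nCk≤2^n (n + n) n) ⟩
  2 ^ (n + n) * 4 ^ n               ≡⟨ cong (λ z → 2 ^ (n + z) * 4 ^ n) (+-identityʳ n) ⟨
  2 ^ (2 * n) * 4 ^ n               ≡⟨ cong (_* 4 ^ n) (^-*-assoc 2 2 n) ⟨
  4 ^ n * 4 ^ n                     ≡⟨ ^-distribˡ-+-* 4 n n ⟨
  4 ^ (n + n)                       ≡⟨ cong (λ z → 4 ^ (n + z)) (+-identityʳ n) ⟨
  4 ^ (2 ^ suc j)                   ∎
  where
  open ≤-Reasoning
  n : ℕ
  n = 2 ^ j

^∣^ : ∀ b {m n} → m ≤ n → b ^ m ∣ b ^ n
^∣^ b {m} {n} m≤n = divides (b ^ (n ∸ m)) (trans (cong (b ^_) (sym (m∸n+n≡m m≤n))) (^-distribˡ-+-* b (n ∸ m) m))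

m<n^m : ∀ n m → 1 < n → m < n ^ m
m<n^m n zero    1<n = s≤s z≤n
m<n^m n (suc m) 1<n = begin-strict
  suc m            ≤⟨ m<n^m n m 1<n ⟩
  n ^ m            <⟨ m<m*n (n ^ m) n {{>-nonZero (≤-<-trans z≤n (m<n^m n m 1<n))}} 1<n ⟩
  n ^ m * n        ≡⟨ *-comm (n ^ m) n ⟩
  n * n ^ m        ∎
  where open ≤-Reasoning

prime⇒>1 : ∀ {q} → Prime q → 1 < q
prime⇒>1 pr = nonTrivial⇒n>1 _ {{prime⇒nonTrivial pr}}

∣-cofactor : ∀ {q j} e o → Prime q → ¬ q ∣ j → q ^ e ∣ o * j → q ^ e ∣ o
∣-cofactor zero    o pr q∤j d = 1∣ o
∣-cofactor {q} {j} (suc e) o pr q∤j d with euclidsLemma o j pr (∣-trans (m∣m*n (q ^ e)) d)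
... | inj₂ q∣j = contradiction q∣j q∤j
... | inj₁ (divides o′ refl) = subst (q * q ^ e ∣_) (*-comm q o′) (*-monoʳ-∣ q (∣-cofactor e o′ pr q∤j
        (*-cancelˡ-∣ q {{prime⇒nonZero pr}} (subst (q * q ^ e ∣_) (rearrange o′ q j) d))))
  where
  rearrange : ∀ o q j → o * q * j ≡ q * (o * j)
  rearrange = solve-∀

extract : ∀ {q} → Prime q → ∀ j → .{{NonZero j}} → ∃₂ λ e j′ → j ≡ q ^ e * j′ × ¬ q ∣ j′
extract {q} pr = <-rec (λ j → .{{NonZero j}} → ∃₂ λ e j′ → j ≡ q ^ e * j′ × ¬ q ∣ j′) step
  where
  step : ∀ j → (∀ {k} → k < j → .{{NonZero k}} → ∃₂ λ e j′ → k ≡ q ^ e * j′ × ¬ q ∣ j′) →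
    .{{NonZero j}} → ∃₂ λ e j′ → j ≡ q ^ e * j′ × ¬ q ∣ j′
  step j rec with q ∣? j
  ... | no q∤j = 0 , j , sym (+-identityʳ j) , q∤j
  ... | yes (divides k@(suc _) refl) with rec (m<m*n k q (prime⇒>1 pr))
  ...   | e , j′ , eq , q∤j′ = suc e , j′ , trans (cong (_* q) eq) (rearrange (q ^ e) j′ q) , q∤j′
    where
    rearrange : ∀ x j q → x * j * q ≡ q * x * j
    rearrange = solve-∀

has-prime-divisor : ∀ n → 1 < n → ∃ λ q → Prime q × q ∣ n
has-prime-divisor n 1<n = pick (factorise n {{>-nonZero (<⇒≤ 1<n)}})
  where
  pick : PrimeFactorisation n → ∃ λ q → Prime q × q ∣ n
  pick record { factors = [] ; isFactorisation = eq } = contradiction eq (>⇒≢ 1<n)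
  pick record { factors = q ∷ qs ; isFactorisation = eq ; factorsPrime = pr ∷ _ } =
    q , pr , subst (q ∣_) (sym eq) (m∣m*n (product qs))

-- Split off the full power of one prime q from j. The cofactor j′ divides L by recursion, and the
-- power of q then divides L / j′, as q does not divide j′.
∣-by-prime-powers : ∀ L j → .{{NonZero j}} → (∀ {q} e → Prime q → q ^ e ∣ j → q ^ e ∣ L) → j ∣ L
∣-by-prime-powers L = <-rec (λ j → .{{NonZero j}} → (∀ {q} e → Prime q → q ^ e ∣ j → q ^ e ∣ L) → j ∣ L) step
  where
  step : ∀ j → (∀ {k} → k < j → .{{NonZero k}} → (∀ {q} e → Prime q → q ^ e ∣ k → q ^ e ∣ L) → k ∣ L) →
    .{{NonZero j}} → (∀ {q} e → Prime q → q ^ e ∣ j → q ^ e ∣ L) → j ∣ L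
  step 1 _ _ = 1∣ L
  step j@(suc (suc _)) rec h with has-prime-divisor j (s≤s (s≤s z≤n))
  ... | q , pr , q∣j with extract pr j
  ...   | zero  , j′ , eq , q∤j′ = contradiction (subst (q ∣_) (trans eq (+-identityʳ j′)) q∣j) q∤j′
  ...   | suc e , zero , eq , _ = contradiction (trans eq (*-zeroʳ (q ^ suc e))) λ ()
  ...   | suc e , j′@(suc _) , eq , q∤j′
    with rec {j′} (subst (j′ <_) (trans (*-comm j′ (q ^ suc e)) (sym eq)) (m<m*n j′ (q ^ suc e) (<-≤-trans (s≤s (s≤s z≤n)) (m<n^m q (suc e) (prime⇒>1 pr)))))
             (λ e′ pr′ d → h e′ pr′ (∣-trans d (subst (j′ ∣_) (sym eq) (n∣m*n (q ^ suc e)))))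
  ...   | divides o refl = subst (_∣ o * j′) (sym eq)
          (*-monoˡ-∣ j′ (∣-cofactor (suc e) o pr q∤j′ (h (suc e) pr (subst (q ^ suc e ∣_) (sym eq) (m∣m*n j′)))))

module _ (m : ℕ) .{{_ : NonZero m}} where

  -- For i > 0, the largest i ^ e ≤ m with e ≤ k. The choice k = m is no restriction for i > 1,
  -- since e < i ^ e.
  max-power : ℕ → ℕ → ℕ
  max-power i zero = 1
  max-power i (suc k) with i ^ suc k ≤? m
  ... | yes _ = i ^ suc k
  ... | no _  = max-power i k

  max-power≤ : ∀ i k → max-power i k ≤ m
  max-power≤ i zero = >-nonZero⁻¹ m
  max-power≤ i (suc k) with i ^ suc k ≤? m
  ... | yes le = le
  ... | no _   = max-power≤ i k

  max-power>0 : ∀ i k → .{{NonZero i}} → 0 < max-power i k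
  max-power>0 i zero = s≤s z≤n
  max-power>0 i (suc k) with i ^ suc k ≤? m
  ... | yes _ = m^n>0 i (suc k)
  ... | no _  = max-power>0 i k

  ^∣max-power : ∀ i k {e} → e ≤ k → i ^ e ≤ m → i ^ e ∣ max-power i k
  ^∣max-power i zero z≤n _ = ∣-refl
  ^∣max-power i (suc k) {e} e≤ le with i ^ suc k ≤? m
  ... | yes _ = ^∣^ i e≤
  ... | no ≰ with m≤n⇒m<n∨m≡n e≤
  ...   | inj₁ (s≤s e≤k) = ^∣max-power i k e≤k le
  ...   | inj₂ refl      = contradiction le ≰

  -- All i ≤ l are taken, not just primes: the crude bound m ^ l is good enough for l = √m.
  power-product : ℕ → ℕ
  power-product zero    = 1
  power-product (suc l) = max-power (suc l) m * power-product l

  power-product≤ : ∀ l → power-product l ≤ m ^ l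
  power-product≤ zero    = ≤-refl
  power-product≤ (suc l) = *-mono-≤ (max-power≤ (suc l) m) (power-product≤ l)

  power-product>0 : ∀ l → 0 < power-product l
  power-product>0 zero    = s≤s z≤n
  power-product>0 (suc l) = *-mono-≤ (max-power>0 (suc l) m) (power-product>0 l)

  max-power∣product : ∀ {i} l → 1 ≤ i → i ≤ l → max-power i m ∣ power-product l
  max-power∣product zero (s≤s _) ()
  max-power∣product (suc l) 1≤i i≤ with m≤n⇒m<n∨m≡n i≤
  ... | inj₁ (s≤s i≤l) = ∣-trans (max-power∣product l 1≤i i≤l) (n∣m*n (max-power (suc l) m))
  ... | inj₂ refl      = m∣m*n _

  -- If there are no primes in (y , m] and S² ≥ m, then the primes ≤ y together with the maximal powers of the numbers ≤ S
  -- account for all prime powers ≤ m.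
  common-multiple : ∀ {y S} → m ≤ S * S → (∀ {q} → Prime q → q ≤ m → q ≤ y) →
    CommonMultiple m (primorial 0 y * power-product S)
  common-multiple {y} {S} m≤S² gap j 1≤j j≤m =
    ∣-by-prime-powers _ j {{>-nonZero 1≤j}} λ e pr d → power e pr (≤-trans (∣⇒≤ {{>-nonZero 1≤j}} d) j≤m)
    where
    power : ∀ {q} e → Prime q → q ^ e ≤ m → q ^ e ∣ primorial 0 y * power-product S
    power {q} e pr le with q ≤? S
    ... | yes q≤S = ∣-trans (∣-trans (^∣max-power q m (<⇒≤ (<-≤-trans (m<n^m q e (prime⇒>1 pr)) le)) le)
                      (max-power∣product S (<⇒≤ (prime⇒>1 pr)) q≤S)) (n∣m*n (primorial 0 y))
    power zero pr le | no _ = 1∣ _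
    power {q} (suc zero) pr le | no _ =
      subst (_∣ primorial 0 y * power-product S) (sym (*-identityʳ q)) (∣-trans (∣primorial y pr (gap pr (subst (_≤ m) (*-identityʳ q) le))) (m∣m*n _))
    power {q} (suc (suc e)) pr le | no q≰S = contradiction le (<⇒≱ (begin-strict
      m                   ≤⟨ m≤S² ⟩
      S * S               <⟨ *-mono-< (≰⇒> q≰S) (≰⇒> q≰S) ⟩
      q * q               ≤⟨ *-monoʳ-≤ q (m≤m*n q (q ^ e) {{m^n≢0 q e {{prime⇒nonZero pr}}}}) ⟩
      q * (q * q ^ e)     ∎))
      where open ≤-Reasoning

-- For w = 6 + v this is the requirement 2 w · 2 ^ w < 2 · 2 ^ (2 w - 3) of `bounded-prime-gap`; it
-- fails at w = 5.
linear<exponential : ∀ v → 2 * (6 + v) < 2 ^ (4 + v)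
linear<exponential zero    = m≤m+n 13 3
linear<exponential (suc v) = begin-strict
  2 * (6 + suc v)          ≡⟨ arith v ⟩
  2 * (6 + v) + 2          ≤⟨ +-monoʳ-≤ (2 * (6 + v)) (≤-trans (m≤m+n 2 10) (≤-trans (*-monoʳ-≤ 2 (m≤m+n 6 v)) (m≤m+n _ 0))) ⟩
  2 * (2 * (6 + v))        <⟨ *-monoʳ-< 2 (linear<exponential v) ⟩
  2 ^ (4 + suc v)          ∎
  where
  open ≤-Reasoning
  arith : ∀ v → 2 * (6 + suc v) ≡ 2 * (6 + v) + 2
  arith = solve-∀

-- Without primes in (y , 8 y], where y = 2 ^ j, a common multiple of 1, …, 8 y would be smaller than 2 ^ (4 y).
bounded-prime-gap : ∀ w j → w + w ≡ 3 + j → (w + w) * 2 ^ w < 2 * 2 ^ j →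
  ∃ λ q → Prime q × 2 ^ w * 2 ^ w < 8 * q × q ≤ 2 ^ w * 2 ^ w
bounded-prime-gap w j w+w≡3+j exponents = search (anyUpTo? (λ q → prime? q ×-dec (m <? 8 * q)) (suc m))
  where
  open ≤-Reasoning
  S m y L : ℕ
  S = 2 ^ w
  m = S * S
  y = 2 ^ j
  instance
    m≢0 : NonZero m
    m≢0 = m*n≢0 S S {{m^n≢0 2 w}} {{m^n≢0 2 w}}
  L = primorial 0 y * power-product m S
  instance
    L≢0 : NonZero L
    L≢0 = m*n≢0 (primorial 0 y) (power-product m S) {{>-nonZero (primorial>0 0 y)}} {{>-nonZero (power-product>0 m S)}}
  -- The ratio 8 leaves room: with m = 4 y, the lower bound 2 ^ (m / 2) would equal the primorial
  -- bound 4 ^ y.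
  m≡8y : m ≡ 8 * y
  m≡8y = trans (sym (^-distribˡ-+-* 2 w w)) (trans (cong (2 ^_) w+w≡3+j) (^-distribˡ-+-* 2 3 j))
  eight : ∀ y → 8 * y ≡ 4 * y + 4 * y
  eight = solve-∀
  four : ∀ y → 2 * y + 2 * y ≡ 4 * y
  four = solve-∀
  too-large : (∀ {q} → Prime q → q ≤ m → q ≤ y) → 2 ^ (4 * y) ≤ 2 ^ (2 * y + (w + w) * S)
  too-large gap = begin
    2 ^ (4 * y)                        ≤⟨ 2^n≤common-multiple (4 * y) {{m*n≢0 4 y {{_}} {{m^n≢0 2 j}}}}
                                            (subst (λ n → CommonMultiple n L) (trans m≡8y (eight y)) (common-multiple m {y} {S} ≤-refl gap)) ⟩
    L                                  ≤⟨ *-mono-≤ (primorial-bound j) (power-product≤ m S) ⟩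
    4 ^ y * m ^ S                      ≡⟨ cong₂ _*_ (^-*-assoc 2 2 y) (trans (cong (_^ S) (sym (^-distribˡ-+-* 2 w w))) (^-*-assoc 2 (w + w) S)) ⟩
    2 ^ (2 * y) * 2 ^ ((w + w) * S)    ≡⟨ ^-distribˡ-+-* 2 (2 * y) ((w + w) * S) ⟨
    2 ^ (2 * y + (w + w) * S)          ∎
  search : Dec (∃ λ q → q < suc m × (Prime q × m < 8 * q)) → ∃ λ q → Prime q × m < 8 * q × q ≤ m
  search (yes (q , s≤s q≤m , pr , large)) = q , pr , large , q≤m
  search (no none) = contradiction (too-large gap) (<⇒≱ (^-monoʳ-< 2 (s≤s (s≤s z≤n))
      (<-≤-trans (+-monoʳ-< (2 * y) exponents) (≤-reflexive (four y)))))
    where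
    gap : ∀ {q} → Prime q → q ≤ m → q ≤ y
    gap {q} pr q≤m = *-cancelˡ-≤ 8 (subst (8 * q ≤_) m≡8y (≮⇒≥ λ lt → none (q , s≤s q≤m , pr , lt)))

prime-between : ∀ v → ∃ λ q → Prime q × 2 ^ (6 + v) * 2 ^ (6 + v) < 8 * q × q ≤ 2 ^ (6 + v) * 2 ^ (6 + v)
prime-between v = bounded-prime-gap (6 + v) (9 + 2 * v) (arith₁ v) (begin-strict
  (6 + v + (6 + v)) * 2 ^ (6 + v)    ≡⟨ cong (_* 2 ^ (6 + v)) (arith₂ v) ⟩
  2 * (6 + v) * 2 ^ (6 + v)          <⟨ *-monoˡ-< (2 ^ (6 + v)) {{m^n≢0 2 (6 + v)}} (linear<exponential v) ⟩
  2 ^ (4 + v) * 2 ^ (6 + v)          ≡⟨ ^-distribˡ-+-* 2 (4 + v) (6 + v) ⟨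
  2 ^ (4 + v + (6 + v))              ≡⟨ cong (2 ^_) (arith₃ v) ⟩
  2 ^ (1 + (9 + 2 * v))              ∎)
  where
  open ≤-Reasoning
  arith₁ : ∀ v → 6 + v + (6 + v) ≡ 3 + (9 + 2 * v)
  arith₁ = solve-∀
  arith₂ : ∀ v → 6 + v + (6 + v) ≡ 2 * (6 + v)
  arith₂ = solve-∀
  arith₃ : ∀ v → 4 + v + (6 + v) ≡ 1 + (9 + 2 * v)
  arith₃ = solve-∀

-- The upper bound

small-residue : ∀ {p a b} → a < p → b < p → ℤ.+ p ∣ᶻ ℤ.+ a ℤ.- ℤ.+ b → a ≡ b
small-residue {p} {a} {b} a<p b<p d = ℤP.+-injective (ℤP.i-j≡0⇒i≡j (ℤ.+ a) (ℤ.+ b) (ℤP.∣i∣≡0⇒i≡0 (zero-of (ℤ.∣ ℤ.+ a ℤ.- ℤ.+ b ∣) below (∣⇒∣ᵤ d))))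
  where
  zero-of : ∀ z → z < p → p ∣ z → z ≡ 0
  zero-of zero    _  _ = refl
  zero-of (suc z) lt d = contradiction (∣⇒≤ d) (<⇒≱ lt)
  below : ℤ.∣ ℤ.+ a ℤ.- ℤ.+ b ∣ < p
  below = subst (λ z → ℤ.∣ z ∣ < p) (sym (ℤP.m-n≡m⊖n a b)) (≤-<-trans (ℤP.∣m⊝n∣≤m⊔n a b) (⊔-lub a<p b<p))

module Construction (p s : ℕ) (p-prime : Prime p) (2∤ : ¬ ℤ.+ p ∣ᶻ ℤ.+ 2) .{{_ : NonZero s}}
  (2s²<p : s * (2 * s) < p) (r : ℕ) (r≤ : r ≤ (s * s) * (s * (s * s))) where

  instance
    p≢0 : NonZero p
    p≢0 = prime⇒nonZero p-prime

  -- J is the number of complete blocks of length s below p. A part has (2 s)³ points and J³ lines.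
  J κ : ℕ
  J = p / s
  κ = 2 * s * (2 * s * (2 * s)) + J * (J * J)

  Js≤p : J * s ≤ p
  Js≤p = m/n*n≤m p s

  s²<p : s * s < p
  s²<p = ≤-<-trans (*-monoʳ-≤ s (m≤n*m s 2)) 2s²<p

  Cube : ℕ → Set
  Cube m = Fin m × Fin m × Fin m

  cube : ∀ {m} → Fin (m * (m * m)) ↔ Cube m
  cube = ↔-trans FinP.*↔× (↔-refl ×-↔ FinP.*↔×)

  Vertex : Set
  Vertex = Fin r × (Cube (2 * s) ⊎ Cube J)

  vertex : Fin (r * κ) ↔ Vertex
  vertex = ↔-trans FinP.*↔× (↔-refl ×-↔ ↔-trans FinP.+↔⊎ (cube ⊎-↔ cube))

  ι : Fin (r * κ) → Vertex
  ι = Inverse.to vertex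

  ι⁻¹ : Vertex → Fin (r * κ)
  ι⁻¹ = Inverse.from vertex

  ι∘ι⁻¹ : ∀ v → ι (ι⁻¹ v) ≡ v
  ι∘ι⁻¹ = Inverse.strictlyInverseˡ vertex

  ι-injective : ∀ {u v} → ι u ≡ ι v → u ≡ v
  ι-injective {u} {v} e = trans (sym (Inverse.strictlyInverseʳ vertex u)) (trans (cong ι⁻¹ e) (Inverse.strictlyInverseʳ vertex v))

  digits : Fin r → Fin (s * s) × Cube s
  digits i = Inverse.to (↔-trans FinP.*↔× (↔-refl ×-↔ cube)) (inject≤ i r≤)

  digits-injective : ∀ {i j} → digits i ≡ digits j → i ≡ j
  digits-injective {i} {j} e = FinP.inject≤-injective r≤ r≤ i j
    (trans (sym (Inverse.strictlyInverseʳ D _)) (trans (cong (Inverse.from D) e) (Inverse.strictlyInverseʳ D _)))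
    where
    D = ↔-trans FinP.*↔× (↔-refl ×-↔ cube)

  -- A point with label (h, α₂, α₃, α₄) and position (j₂, j₃, j₄) has coordinates h and 2 s αₖ + jₖ;
  -- a line with label (h, β₂, β₃, β₄) and position (j₂, j₃, j₄) has coordinates h and s jₖ + βₖ.
  side : Vertex → Bool
  side (_ , inj₁ _) = true
  side (_ , inj₂ _) = false

  c₁ c₂ c₃ c₄ : Vertex → ℤ
  c₁ (i , _) = ℤ.+ toℕ (proj₁ (digits i))
  c₂ (i , inj₁ (j , _ , _)) = ℤ.+ toℕ (combine (proj₁ (proj₂ (digits i))) j)
  c₂ (i , inj₂ (j , _ , _)) = ℤ.+ toℕ (combine j (proj₁ (proj₂ (digits i))))
  c₃ (i , inj₁ (_ , j , _)) = ℤ.+ toℕ (combine (proj₁ (proj₂ (proj₂ (digits i)))) j)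
  c₃ (i , inj₂ (_ , j , _)) = ℤ.+ toℕ (combine j (proj₁ (proj₂ (proj₂ (digits i)))))
  c₄ (i , inj₁ (_ , _ , j)) = ℤ.+ toℕ (combine (proj₂ (proj₂ (proj₂ (digits i)))) j)
  c₄ (i , inj₂ (_ , _ , j)) = ℤ.+ toℕ (combine j (proj₂ (proj₂ (proj₂ (digits i)))))

  open Mod p p-prime 2∤ using (Null; null?)
  open Incidence p p-prime 2∤ side c₁ c₂ c₃ c₄

  fin-residue : ∀ {m} {i j : Fin m} → m ≤ p → Null (ℤ.+ toℕ i ℤ.- ℤ.+ toℕ j) → i ≡ j
  fin-residue {i = i} {j} m≤p n = FinP.toℕ-injective
    (small-residue (<-≤-trans (FinP.toℕ<n i) m≤p) (<-≤-trans (FinP.toℕ<n j) m≤p) n)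

  point-digit : ∀ {α α′ : Fin s} {j j′ : Fin (2 * s)} → Null (ℤ.+ toℕ (combine α j) ℤ.- ℤ.+ toℕ (combine α′ j′)) → α ≡ α′ × j ≡ j′
  point-digit n = FinP.combine-injective _ _ _ _ (fin-residue (<⇒≤ 2s²<p) n)

  line-digit : ∀ {β β′ : Fin s} {j j′ : Fin J} → Null (ℤ.+ toℕ (combine j β) ℤ.- ℤ.+ toℕ (combine j′ β′)) → j ≡ j′ × β ≡ β′
  line-digit n = FinP.combine-injective _ _ _ _ (fin-residue Js≤p n)

  -- All coordinates are below p, since 2 s² < p and J s ≤ p; congruent ones are equal and have the
  -- same digits.
  faithful : ∀ {v w} → side v ≡ side w → Null (c₁ v ℤ.- c₁ w) → Null (c₂ v ℤ.- c₂ w) →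
    Null (c₃ v ℤ.- c₃ w) → Null (c₄ v ℤ.- c₄ w) → v ≡ w
  faithful {_ , inj₁ _} {_ , inj₁ _} _ n₁ n₂ n₃ n₄ =
    let e₂ , f₂ = point-digit n₂
        e₃ , f₃ = point-digit n₃
        e₄ , f₄ = point-digit n₄
    in cong₂ _,_ (digits-injective (cong₂ _,_ (fin-residue (<⇒≤ s²<p) n₁) (cong₂ _,_ e₂ (cong₂ _,_ e₃ e₄))))
                 (cong inj₁ (cong₂ _,_ f₂ (cong₂ _,_ f₃ f₄)))
  faithful {_ , inj₂ _} {_ , inj₂ _} _ n₁ n₂ n₃ n₄ =
    let f₂ , e₂ = line-digit n₂
        f₃ , e₃ = line-digit n₃
        f₄ , e₄ = line-digit n₄
    in cong₂ _,_ (digits-injective (cong₂ _,_ (fin-residue (<⇒≤ s²<p) n₁) (cong₂ _,_ e₂ (cong₂ _,_ e₃ e₄))))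
                 (cong inj₂ (cong₂ _,_ f₂ (cong₂ _,_ f₃ f₄)))
  faithful {_ , inj₁ _} {_ , inj₂ _} ()
  faithful {_ , inj₂ _} {_ , inj₁ _} ()

  incident? : ∀ v w → Dec (Incident c₃ c₄ v w)
  incident? v w = map′ (λ (i , j , k) → incident i j k) (λ (incident i j k) → i , j , k)
    (null? _ ×-dec (null? _ ×-dec null? _))

  adjacent? : ∀ v w → Dec (Adjacent v w)
  adjacent? v w =
    ((side v BoolP.≟ true) ×-dec ((side w BoolP.≟ false) ×-dec incident? v w)) ⊎-dec
    ((side v BoolP.≟ false) ×-dec ((side w BoolP.≟ true) ×-dec incident? w v))

  adjacent-irrefl : ∀ v → ¬ Adjacent v v
  adjacent-irrefl v (inj₁ (s , t , _)) = contradiction (trans (sym s) t) λ ()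
  adjacent-irrefl v (inj₂ (s , t , _)) = contradiction (trans (sym s) t) λ ()

  graph : Graph
  graph = record
    { n        = r * κ
    ; adj      = λ u v → does (adjacent? (ι u) (ι v))
    ; sym      = λ u v → does-⇔ (mk⇔ Adjacent-sym Adjacent-sym) (adjacent? (ι u) (ι v)) (adjacent? (ι v) (ι u))
    ; loopless = λ v → dec-false (adjacent? (ι v) (ι v)) (adjacent-irrefl (ι v))
    }

  does⇒ : ∀ {P : Set} (P? : Dec P) → does P? ≡ true → P
  does⇒ (yes p) _ = p

  graph-theta-free : ThetaFree 3 4 graph
  graph-theta-free = Faithful.theta-free faithful graph ι ι-injective λ {u} {v} → does⇒ (adjacent? (ι u) (ι v))

  part : Fin (r * κ) → Fin r
  part v = proj₁ (ι v)

  part-small : ∀ i → partSize part i ≤ κ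
  part-small i = ≤-trans (≤-reflexive (partSize≡ part i))
    (#≤-injection (λ v → part v ≟F i) (λ v → proj₂ (remQuot {r} κ v)) inj)
    where
    inj : ∀ {u v} → part u ≡ i → part v ≡ i → proj₂ (remQuot {r} κ u) ≡ proj₂ (remQuot {r} κ v) → u ≡ v
    inj {u} {v} pu pv e = trans (sym (FinP.combine-remQuot {r} κ u))
      (trans (cong₂ combine (trans pu (sym pv)) e) (FinP.combine-remQuot {r} κ v))

  -- The incomplete last block g ≥ J s is absorbed by the block before it, which is why j ranges up to 2 s.
  split : ∀ g → g < p → Σ (Fin (2 * s)) λ j → Σ (Fin J) λ j′ → toℕ j + s * toℕ j′ ≡ g
  split g g<p with g / s <? J
  ... | yes lt = fromℕ< r<2s , fromℕ< lt ,
        trans (cong₂ (λ a b → a + s * b) (FinP.toℕ-fromℕ< r<2s) (FinP.toℕ-fromℕ< lt))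
          (trans (cong (g % s +_) (*-comm s (g / s))) (sym (m≡m%n+[m/n]*n g s)))
    where
    r<2s : g % s < 2 * s
    r<2s = <-≤-trans (m%n<n g s) (m≤n*m s 2)
  ... | no ≮ = fromℕ< a<2s , fromℕ< J-1<J ,
        trans (cong₂ (λ a b → a + s * b) (FinP.toℕ-fromℕ< a<2s) (FinP.toℕ-fromℕ< J-1<J)) (m∸n+n≡m below)
    where
    J-1 : ℕ
    J-1 = J ∸ 1
    1≤J : 1 ≤ J
    1≤J = m≥n⇒m/n>0 (<⇒≤ (≤-<-trans (m≤m*n s s) s²<p))
    sucJ : suc J-1 ≡ J
    sucJ = m+[n∸m]≡n 1≤J
    J-1<J : J-1 < J
    J-1<J = ≤-reflexive sucJ
    below : s * J-1 ≤ g
    below = ≤-trans (≤-reflexive (*-comm s J-1))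
      (≤-trans (*-monoˡ-≤ s (≤-trans (<⇒≤ J-1<J) (≮⇒≥ ≮))) (m/n*n≤m g s))
    a<2s : g ∸ s * J-1 < 2 * s
    a<2s = +-cancelʳ-< (s * J-1) _ _ (begin-strict
      g ∸ s * J-1 + s * J-1  ≡⟨ m∸n+n≡m below ⟩
      g                                <⟨ g<p ⟩
      p                                ≡⟨ m≡m%n+[m/n]*n p s ⟩
      p % s + J * s             ≤⟨ +-monoˡ-≤ _ (<⇒≤ (m%n<n p s)) ⟩
      s + J * s                   ≡⟨ cong (λ j → s + j * s) sucJ ⟨
      s + (s + J-1 * s)         ≡⟨ trans (sym (+-assoc s s _)) (cong₂ _+_ (cong (s +_) (sym (+-identityʳ s))) (*-comm J-1 s)) ⟩
      2 * s + s * J-1           ∎)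
      where open ≤-Reasoning

  -- The prescribed digits contribute y = 2 s α + β. The free ones contribute j + s j′, which by
  -- `split` can be any residue, in particular that of f - y.
  solve-digit : ∀ (α β : Fin s) (f : ℤ) → Σ (Fin (2 * s)) λ j → Σ (Fin J) λ j′ →
    Null (ℤ.+ toℕ (combine α j) ℤ.+ ℤ.+ toℕ (combine j′ β) ℤ.- f)
  solve-digit α β f =
    let j , j′ , e = split g (n%ℕd<d (f ℤ.- ℤ.+ y) p) in j , j′ , divides (ℤ.- q) (eq j j′ e)
    where
    y g : ℕ
    y = 2 * s * toℕ α + toℕ β
    g = (f ℤ.- ℤ.+ y) %ℕ p
    q : ℤ
    q = (f ℤ.- ℤ.+ y) /ℕ p
    id₁ : ∀ a j b k → a + j + (k + b) ≡ (a + b) + (j + k)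
    id₁ = solve-∀
    id₂ : ∀ y g f q x → f ℤ.- y ≡ g ℤ.+ q ℤ.* x → y ℤ.+ g ℤ.- f ≡ ℤ.- q ℤ.* x
    id₂ y g f q x e = trans (id₃ y g f) (trans (cong (λ z → g ℤ.- z) e) (id₄ g q x))
      where
      id₃ : ∀ y g f → y ℤ.+ g ℤ.- f ≡ g ℤ.- (f ℤ.- y)
      id₃ = ℤSolver.solve-∀
      id₄ : ∀ g q x → g ℤ.- (g ℤ.+ q ℤ.* x) ≡ ℤ.- q ℤ.* x
      id₄ = ℤSolver.solve-∀
    eq : ∀ j j′ → toℕ j + s * toℕ j′ ≡ g → ℤ.+ toℕ (combine α j) ℤ.+ ℤ.+ toℕ (combine j′ β) ℤ.- f ≡ ℤ.- q ℤ.* ℤ.+ p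
    eq j j′ e = trans (cong (ℤ._- f) sum≡) (id₂ (ℤ.+ y) (ℤ.+ g) f q (ℤ.+ p) (a≡a%ℕn+[a/ℕn]*n (f ℤ.- ℤ.+ y) p))
      where
      sum≡ : ℤ.+ toℕ (combine α j) ℤ.+ ℤ.+ toℕ (combine j′ β) ≡ ℤ.+ y ℤ.+ ℤ.+ g
      sum≡ = cong ℤ.+_ (trans (cong₂ _+_ (FinP.toℕ-combine α j) (FinP.toℕ-combine j′ β))
        (trans (id₁ (2 * s * toℕ α) (toℕ j) (toℕ β) (s * toℕ j′)) (cong (y +_) e)))

  cross : ∀ i j → ∃₂ λ u v → part u ≡ i × part v ≡ j × Edge graph u v
  cross i j =
    let x = ℤ.+ toℕ (proj₁ (digits i))
        y = ℤ.+ toℕ (proj₁ (digits j))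
        a₂ , b₂ , n₂ = solve-digit (proj₁ (proj₂ (digits i))) (proj₁ (proj₂ (digits j))) (x ℤ.* y)
        a₃ , b₃ , n₃ = solve-digit (proj₁ (proj₂ (proj₂ (digits i)))) (proj₁ (proj₂ (proj₂ (digits j)))) (x ℤ.* (y ℤ.* y))
        a₄ , b₄ , n₄ = solve-digit (proj₂ (proj₂ (proj₂ (digits i)))) (proj₂ (proj₂ (proj₂ (digits j)))) (x ℤ.* x ℤ.* y)
        v = i , inj₁ (a₂ , a₃ , a₄)
        w = j , inj₂ (b₂ , b₃ , b₄)
    in ι⁻¹ v , ι⁻¹ w , cong proj₁ (ι∘ι⁻¹ v) , cong proj₁ (ι∘ι⁻¹ w) ,
       trans (cong₂ (λ v w → does (adjacent? v w)) (ι∘ι⁻¹ v) (ι∘ι⁻¹ w))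
             (dec-true (adjacent? v w) (inj₁ (refl , refl , incident n₂ n₃ n₄)))

  graph-RK : IsRKGraph r κ graph
  graph-RK = part , part-small , λ i j _ → cross i j

-- Decidability

-- Functions are enumerated only up to pointwise equality, so without function extensionality the
-- predicate has to respect a relation ≈.
Searchable : (A : Set) → (A → A → Set) → Set₁
Searchable A _≈_ = ∀ {P : A → Set} → (∀ x → Dec (P x)) → (∀ {x y} → x ≈ y → P x → P y) → Dec (∃ P)

searchable-Fin : ∀ {n} → Searchable (Fin n) _≡_
searchable-Fin P? _ = FinP.any? P?

searchable-Bool : Searchable Bool _≡_
searchable-Bool P? _ with P? true | P? false
... | yes p | _     = yes (true , p)
... | no _  | yes p = yes (false , p)
... | no ¬t | no ¬f = no λ { (true , p) → ¬t p ; (false , p) → ¬f p }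

searchable-→ : ∀ {A : Set} {_≈_ : A → A → Set} → (∀ {a} → a ≈ a) → Searchable A _≈_ →
  ∀ n → Searchable (Fin n → A) (λ f g → ∀ i → f i ≈ g i)
searchable-→ _ _ zero P? resp = map′ (λ p → _ , p) (λ (_ , p) → resp (λ ()) p) (P? λ ())
searchable-→ {A} {_≈_} ≈-refl search (suc n) {P} P? resp = map′ (λ (a , f , p) → a ∷ᶠ f , p) unfold
  (search {λ a → ∃ λ f → P (a ∷ᶠ f)}
    (λ a → searchable-→ {A} {_≈_} ≈-refl search n (λ f → P? (a ∷ᶠ f)) (λ e → resp λ { zero → ≈-refl ; (suc i) → e i }))
    (λ e (f , p) → f , resp (λ { zero → e ; (suc i) → ≈-refl }) p))
  where
  unfold : ∃ P → ∃ λ a → ∃ λ f → P (a ∷ᶠ f)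
  unfold (g , p) = g zero , g ∘ suc , resp (λ { zero → ≈-refl ; (suc i) → ≈-refl }) p

theta-copy? : ∀ K ℓ G → Dec (ThetaCopy K ℓ G)
theta-copy? K ℓ G = FinP.any? λ x → FinP.any? λ y →
  searchable-→ (λ _ → refl) (searchable-→ refl searchable-Fin (suc ℓ)) K
    (λ W → FinP.all? (λ i → W i zero ≟F x) ×-dec (FinP.all? (λ i → W i (fromℕ ℓ) ≟F y) ×-dec
      (FinP.all? (λ i → FinP.all? λ j → adj G (W i (inject₁ j)) (W i (suc j)) BoolP.≟ true) ×-dec
       FinP.all? (λ i → FinP.all? λ i′ → FinP.all? λ j → FinP.all? λ j′ → (W i j ≟F W i′ j′) →-dec
         (((i ≟F i′) ×-dec (j ≟F j′)) ⊎-dec (((j ≟F zero) ×-dec (j′ ≟F zero)) ⊎-dec ((j ≟F fromℕ ℓ) ×-dec (j′ ≟F fromℕ ℓ))))))))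
    (λ e (start , end , edges , disjoint) →
      (λ i → trans (sym (e i zero)) (start i)) , (λ i → trans (sym (e i (fromℕ ℓ))) (end i)) ,
      (λ i j → subst₂ (Edge G) (e i (inject₁ j)) (e i (suc j)) (edges i j)) ,
      λ i i′ j j′ eq → disjoint i i′ j j′ (trans (e i j) (trans eq (sym (e i′ j′)))))

partSize-cong : ∀ {m r} {p q : Fin m → Fin r} → (∀ v → p v ≡ q v) → ∀ i → partSize p i ≡ partSize q i
partSize-cong {p = p} {q} e i = trans (partSize≡ p i) (trans
  (≤-antisym (#-mono λ {v} h → trans (sym (e v)) h) (#-mono λ {v} h → trans (e v) h)) (sym (partSize≡ q i)))

RK? : ∀ r k G → Dec (IsRKGraph r k G)
RK? r k G = searchable-→ refl searchable-Fin (Graph.n G)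
  (λ p → FinP.all? (λ i → partSize p i ≤? k) ×-dec
    FinP.all? λ i → FinP.all? λ j → ¬? (i ≟F j) →-dec
      FinP.any? λ u → FinP.any? λ v → (p u ≟F i) ×-dec ((p v ≟F j) ×-dec (adj G u v BoolP.≟ true)))
  (λ e (small , cross) → (λ i → subst (_≤ k) (partSize-cong e i) (small i)) ,
    λ i j i≢j → let u , v , pu , pv , uv = cross i j i≢j in u , v , trans (sym (e u)) pu , trans (sym (e v)) pv , uv)

module _ (r K ℓ k : ℕ) where

  FreeRK : ∀ n → (Fin n → Fin n → Bool) → Set
  FreeRK n a = Σ (∀ u v → a u v ≡ a v u) λ s → Σ (∀ v → a v v ≡ false) λ l →
    let G = record { n = n ; adj = a ; sym = s ; loopless = l } in ThetaFree K ℓ G × IsRKGraph r k G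

  freeRK? : ∀ n a → Dec (FreeRK n a)
  freeRK? n a with FinP.all? (λ u → FinP.all? λ v → a u v BoolP.≟ a v u) | FinP.all? (λ v → a v v BoolP.≟ false)
  ... | no ¬s | _     = no λ (s , _) → ¬s s
  ... | yes _ | no ¬l = no λ (_ , l , _) → ¬l l
  -- `ThetaFree` and `IsRKGraph` read only `n` and `adj`, so h fits any proofs of symmetry and
  -- looplessness.
  ... | yes s | yes l = map′ (λ h → s , l , h) (λ (_ , _ , h) → h) (¬? (theta-copy? K ℓ G) ×-dec RK? r k G)
    where
    G : Graph
    G = record { n = n ; adj = a ; sym = s ; loopless = l }

  freeRK-resp : ∀ n {a b : Fin n → Fin n → Bool} → (∀ u v → a u v ≡ b u v) → FreeRK n a → FreeRK n b
  freeRK-resp n e (s , l , free , p , small , cross) =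
    (λ u v → trans (sym (e u v)) (trans (s u v) (e v u))) , (λ v → trans (sym (e v v)) (l v)) ,
    (λ (x , y , W , start , end , edges , disjoint) → free (x , y , W , start , end , (λ i j → trans (e _ _) (edges i j)) , disjoint)) ,
    p , small , λ i j i≢j → let u , v , pu , pv , uv = cross i j i≢j in u , v , pu , pv , trans (sym (e u v)) uv

  -- r parts of size at most k leave at most r k vertices, so finitely many adjacency matrices
  -- remain.
  hasFreeRK? : Dec (HasFreeRK r K ℓ k)
  hasFreeRK? = map′
    (λ (n , _ , a , s , l , free , rk) → record { n = n ; adj = a ; sym = s ; loopless = l } , free , rk)
    (λ (G , free , rk@(p , small , _)) →
      Graph.n G , s≤s (vertices≤ p small) , adj G , Graph.sym G , loopless G , free , rk)
    (anyUpTo? (λ n → searchable-→ (λ _ → refl) (searchable-→ refl searchable-Bool n) n (freeRK? n) (freeRK-resp n)) (suc (r * k)))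

least : ∀ {P : ℕ → Set} → (∀ k → Dec (P k)) → ∀ k → 1 ≤ k → P k →
  ∃ λ m → m ≤ k × 1 ≤ m × P m × (∀ j → 1 ≤ j → j < m → ¬ P j)
least {P} P? = <-rec (λ k → 1 ≤ k → P k → ∃ λ m → m ≤ k × 1 ≤ m × P m × (∀ j → 1 ≤ j → j < m → ¬ P j)) step
  where
  step : ∀ k → (∀ {j} → j < k → 1 ≤ j → P j → ∃ λ m → m ≤ j × 1 ≤ m × P m × (∀ j → 1 ≤ j → j < m → ¬ P j)) →
    1 ≤ k → P k → ∃ λ m → m ≤ k × 1 ≤ m × P m × (∀ j → 1 ≤ j → j < m → ¬ P j)
  step k rec 1≤k pk with anyUpTo? (λ j → (1 ≤? j) ×-dec P? j) k
  ... | no none = k , ≤-refl , 1≤k , pk , λ j 1≤j j<k pj → none (j , j<k , 1≤j , pj)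
  ... | yes (j , j<k , 1≤j , pj) = let m , m≤j , rest = rec j<k 1≤j pj in m , ≤-trans m≤j (<⇒≤ j<k) , rest

-- Choice of the scale s and comparison of constants

fifth : ℕ → ℕ
fifth s = s * s * (s * (s * s))

opaque
  -- 2²⁰ = 16⁵ is the loss at r = 1, where s = 16 is the first scale served by `prime-between`. 4104
  -- = 2³ + 16³ bounds points and lines of a part in units of s³.
  scale-loss part-cost : ℕ
  scale-loss = 2 ^ 20
  part-cost  = 4104

  16⁵≤scale-loss : fifth 16 ≤ scale-loss
  16⁵≤scale-loss = ≤-refl

  32≤scale-loss : 32 ≤ scale-loss
  32≤scale-loss = from-yes (32 ≤? 2 ^ 20)

  cubes≡part-cost : ∀ x → 2 * (2 * 2) * x + 16 * (16 * 16) * x ≡ part-cost * x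
  cubes≡part-cost x = sym (*-distribʳ-+ x (2 * (2 * 2)) (16 * (16 * 16)))

-- Induction on r: s is kept until r + 1 exceeds s⁵. At that moment s⁵ = r, and doubling s gives 32
-- r.
scale : ∀ r → 1 ≤ r → ∃ λ v → r ≤ fifth (2 ^ (4 + v)) × fifth (2 ^ (4 + v)) ≤ scale-loss * r
scale 1 _ = 0 , m≤m+n 1 _ , ≤-trans 16⁵≤scale-loss (≤-reflexive (sym (*-identityʳ scale-loss)))
scale (suc r@(suc _)) _ with scale r (s≤s z≤n)
... | v , r≤ , ≤r with suc r ≤? fifth (2 ^ (4 + v))
...   | yes le = v , le , ≤-trans ≤r (*-monoʳ-≤ scale-loss (n≤1+n r))
...   | no  ≰  = suc v , ≤-trans larger (≤-reflexive (sym fifth-double)) , (begin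
          fifth (2 ^ (4 + suc v))     ≡⟨ fifth-double ⟩
          32 * r                      ≤⟨ *-mono-≤ 32≤scale-loss (n≤1+n r) ⟩
          scale-loss * suc r          ∎)
  where
  open ≤-Reasoning
  double : ∀ s → fifth (2 * s) ≡ 32 * fifth s
  double = expand
    where
    expand : ∀ s → 2 * s * (2 * s) * (2 * s * (2 * s * (2 * s))) ≡ 32 * (s * s * (s * (s * s)))
    expand = solve-∀
  fifth-double : fifth (2 ^ (4 + suc v)) ≡ 32 * r
  fifth-double = trans (double (2 ^ (4 + v))) (cong (32 *_) (≤-antisym (≤-pred (≰⇒> ≰)) r≤))
  larger : suc r ≤ 32 * r
  larger = ≤-trans (+-monoˡ-≤ r (s≤s (z≤n {_}))) (+-monoʳ-≤ r (m≤m+n r _))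

opaque
  upper-constant : ℕ
  upper-constant = suc (part-cost ^ 5 * scale-loss ^ 3)

  1≤upper-constant : 1 ≤ upper-constant
  1≤upper-constant = s≤s z≤n

  upper-constant-suc : upper-constant ≡ suc (part-cost ^ 5 * scale-loss ^ 3)
  upper-constant-suc = refl

parts≤ : ∀ {p s} .{{_ : NonZero s}} → p ≤ 16 * (s * s) →
  2 * s * (2 * s * (2 * s)) + p / s * (p / s * (p / s)) ≤ part-cost * (s * (s * s))
parts≤ {p} {s} p≤ = begin
  2 * s * (2 * s * (2 * s)) + p / s * (p / s * (p / s))
    ≤⟨ +-monoʳ-≤ (2 * s * (2 * s * (2 * s))) (*-mono-≤ J≤ (*-mono-≤ J≤ J≤)) ⟩
  2 * s * (2 * s * (2 * s)) + 16 * s * (16 * s * (16 * s))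
    ≡⟨ trans (arith 2 16 s) (cubes≡part-cost (s * (s * s))) ⟩
  part-cost * (s * (s * s)) ∎
  where
  open ≤-Reasoning
  J≤ : p / s ≤ 16 * s
  J≤ = ≤-trans (/-monoˡ-≤ s (≤-trans p≤ (≤-reflexive (sym (*-assoc 16 s s))))) (≤-reflexive (m*n/n≡m (16 * s) s))
  arith : ∀ a b s → a * s * (a * s * (a * s)) + b * s * (b * s * (b * s)) ≡ a * (a * a) * (s * (s * s)) + b * (b * b) * (s * (s * s))
  arith = solve-∀

-- With S = 4 s, a prime between S² / 8 and S² lies between 2 s² and 16 s²: large enough for the
-- digits of points, small enough for J ≤ 16 s.
free-graph : ∀ r v → r ≤ fifth (2 ^ (4 + v)) →
  ∃ λ k → 1 ≤ k × k ≤ part-cost * (2 ^ (4 + v) * (2 ^ (4 + v) * 2 ^ (4 + v))) × HasFreeRK r 3 4 k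
free-graph r v r≤ = construct (2 ^ (4 + v)) r≤ {{m^n≢0 2 (4 + v)}} (prime-near (prime-between v))
  where
  prime-near : (∃ λ q → Prime q × 2 ^ (6 + v) * 2 ^ (6 + v) < 8 * q × q ≤ 2 ^ (6 + v) * 2 ^ (6 + v)) →
    ∃ λ q → Prime q × 2 ^ (4 + v) * (2 * 2 ^ (4 + v)) < q × q ≤ 16 * (2 ^ (4 + v) * 2 ^ (4 + v))
  prime-near (q , pr , lo , hi) = q , pr ,
    *-cancelˡ-< 8 _ _ (≤-<-trans (≤-reflexive (arith₁ (2 ^ (4 + v)))) (subst (_< 8 * q) square lo)) ,
    ≤-trans hi (≤-reflexive (trans square (arith₂ (2 ^ (4 + v)))))
    where
    square : 2 ^ (6 + v) * 2 ^ (6 + v) ≡ 4 * 2 ^ (4 + v) * (4 * 2 ^ (4 + v))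
    square = cong₂ _*_ (^-distribˡ-+-* 2 2 (4 + v)) (^-distribˡ-+-* 2 2 (4 + v))
    arith₁ : ∀ s → 8 * (s * (2 * s)) ≡ 4 * s * (4 * s)
    arith₁ = solve-∀
    arith₂ : ∀ s → 4 * s * (4 * s) ≡ 16 * (s * s)
    arith₂ = solve-∀
  construct : ∀ s → r ≤ fifth s → .{{_ : NonZero s}} → (∃ λ q → Prime q × s * (2 * s) < q × q ≤ 16 * (s * s)) →
    ∃ λ k → 1 ≤ k × k ≤ part-cost * (s * (s * s)) × HasFreeRK r 3 4 k
  construct s r≤ (q , pr , lo , hi) =
    C.κ , ≤-trans (>-nonZero⁻¹ _ {{m*n≢0 (2 * s) _ {{2s≢0}} {{m*n≢0 (2 * s) (2 * s) {{2s≢0}} {{2s≢0}}}}}}) (m≤m+n _ _) ,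
    parts≤ hi , C.graph , C.graph-theta-free , C.graph-RK
    where
    2s≢0 : NonZero (2 * s)
    2s≢0 = m*n≢0 2 s
    2∤ : ¬ ℤ.+ q ∣ᶻ ℤ.+ 2
    2∤ d = <⇒≱ (≤-<-trans (*-mono-≤ (>-nonZero⁻¹ s) (m≤m*n 2 s)) lo) (∣⇒≤ (∣⇒∣ᵤ d))
    module C = Construction q s pr 2∤ lo r r≤

theorem1p7 : Σ ℕ λ N → Σ ℕ λ M → 1 ≤ N × 1 ≤ M ×
    (∀ r → 1 ≤ r → Σ ℕ λ k → IsF r 3 4 k × (r ^ 3 < N * k ^ 5) × (k ^ 5 < M * r ^ 3))
theorem1p7 = (2 * lower-constant) ^ 4 , upper-constant , m^n>0 (2 * lower-constant) {{m*n≢0 2 lower-constant}} 4 , 1≤upper-constant , bounds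
  where
  open ≤-Reasoning
  instance
    lower≢0 : NonZero lower-constant
    lower≢0 = lower-constant≢0
  cube : ∀ s → fifth s ^ 3 ≡ (s * (s * s)) ^ 5
  cube s = trans (collect (s * s) (s * (s * s))) (expand s (s * (s * s)))
    where
    collect : ∀ a c → a * c * (a * c * (a * c * 1)) ≡ a * (a * a) * (c * (c * c))
    collect = solve-∀
    expand : ∀ s c → s * s * (s * s * (s * s)) * (c * (c * c)) ≡ s * (s * s) * (s * (s * s) * (c * (c * (c * 1))))
    expand = solve-∀
  upper : ∀ {r k} s → 1 ≤ r → k ≤ part-cost * (s * (s * s)) → fifth s ≤ scale-loss * r → k ^ 5 < upper-constant * r ^ 3
  upper {r} {k} s 1≤r k≤ s≤ = begin-strict
    k ^ 5                                        ≤⟨ ^-monoˡ-≤ 5 k≤ ⟩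
    (part-cost * (s * (s * s))) ^ 5              ≡⟨ ^-distribʳ-* 5 part-cost (s * (s * s)) ⟩
    part-cost ^ 5 * (s * (s * s)) ^ 5            ≡⟨ cong (part-cost ^ 5 *_) (cube s) ⟨
    part-cost ^ 5 * fifth s ^ 3                  ≤⟨ *-monoʳ-≤ (part-cost ^ 5) (^-monoˡ-≤ 3 s≤) ⟩
    part-cost ^ 5 * (scale-loss * r) ^ 3         ≡⟨ cong (part-cost ^ 5 *_) (^-distribʳ-* 3 scale-loss r) ⟩
    part-cost ^ 5 * (scale-loss ^ 3 * r ^ 3)     ≡⟨ *-assoc (part-cost ^ 5) (scale-loss ^ 3) (r ^ 3) ⟨
    part-cost ^ 5 * scale-loss ^ 3 * r ^ 3       <⟨ *-monoˡ-< (r ^ 3) {{m^n≢0 r 3 {{>-nonZero 1≤r}}}} (n<1+n (part-cost ^ 5 * scale-loss ^ 3)) ⟩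
    suc (part-cost ^ 5 * scale-loss ^ 3) * r ^ 3 ≡⟨ cong (_* r ^ 3) upper-constant-suc ⟨
    upper-constant * r ^ 3                       ∎
  Goal : ℕ → Set
  Goal r = Σ ℕ λ k → IsF r 3 4 k × (r ^ 3 < (2 * lower-constant) ^ 4 * k ^ 5) × (k ^ 5 < upper-constant * r ^ 3)
  -- The lower bound is applied to the graph that attains the least k, the upper bound to k ≤ k₀.
  minimal-k : ∀ {r k₀} s → 1 ≤ r → k₀ ≤ part-cost * (s * (s * s)) → fifth s ≤ scale-loss * r →
    (∃ λ k → k ≤ k₀ × 1 ≤ k × HasFreeRK r 3 4 k × (∀ j → 1 ≤ j → j < k → ¬ HasFreeRK r 3 4 j)) → Goal r
  minimal-k s 1≤r k₀≤ ≤r (k , k≤k₀ , 1≤k , free@(G , θ-free , rk) , minimal) =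
    k , (1≤k , free , minimal) ,
    lower-bound G {{>-nonZero 1≤r}} {{>-nonZero 1≤k}} θ-free rk ,
    upper s 1≤r (≤-trans k≤k₀ k₀≤) ≤r
  at-scale : ∀ {r} → 1 ≤ r → (∃ λ v → r ≤ fifth (2 ^ (4 + v)) × fifth (2 ^ (4 + v)) ≤ scale-loss * r) → Goal r
  at-scale {r} 1≤r (v , r≤ , ≤r) = search (free-graph r v r≤)
    where
    search : (∃ λ k → 1 ≤ k × k ≤ part-cost * (2 ^ (4 + v) * (2 ^ (4 + v) * 2 ^ (4 + v))) × HasFreeRK r 3 4 k) → Goal r
    search (k₀ , 1≤k₀ , k₀≤ , free₀) =
      minimal-k (2 ^ (4 + v)) 1≤r k₀≤ ≤r (least (hasFreeRK? r 3 4) k₀ 1≤k₀ free₀)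
  bounds : ∀ r → 1 ≤ r → Goal r
  bounds r 1≤r = at-scale 1≤r (scale r 1≤r)
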